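{- For all integers $n\geq 2$ and $k\geq 1$, $$2nb_{2n,k}=[k(k+1)+2n-2]b_{2n-2,k}+[2+2(k-1)(4n-4k-3)]b_{2n-2,k-1}+8(n-k+1)(2n-2k+1)b_{2n-2,k-2},$$ where $b_{2m,j}=0$ if $j<1$ or $j>m$.
   Context: For a permutation $\pi=a_1\cdots a_m$ of $\{1,\ldots,m\}$, a descent is an index $1\le i\le m-1$ with $a_i>a_{i+1}$. A fixed-point free involution is a permutation $\pi$ with $\pi^2=\mathrm{id}$ and no fixed points. Let $J_{m,j}$ be the number of fixed-point free involutions of $\{1,\ldots,m\}$ with exactly $j$ descents, and $J_{m}(t)=\sum_j J_{m,j}t^j$. For $m\geq1$ and $1\leq j\leq m$ define $$b_{2m,j}=\sum_{i=1}^{j}(-1)^{j-i}\frac{2m-2i}{2m-j-i}\binom{2m-j-i}{j-i}J_{2m,i}\quad\text{if }j<m,$$ $$b_{2m,j}=J_{2m,j}+\sum_{i=1}^{j-1}(-1)^{j-i}\frac{2m-2i}{2m-j-i}\binom{2m-j-i}{j-i}J_{2m,i}\quad\text{if }j=m.$$ These are the coefficients satisfying $J_{2m}(t)=\sum_{j=1}^{m}b_{2m,j}t^j(1+t)^{2m-2j}$. -}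

module Defs where

open import Data.Nat.Base as ℕ using (ℕ; zero; suc; _∸_)
open import Data.Nat.Combinatorics using (_C_)
open import Data.Nat.Properties as ℕ using (<-cmp)
open import Data.Integer.Base as ℤ using (ℤ; +_; -[1+_]; -1ℤ)
open import Data.Rational.Base as ℚ using (ℚ; 0ℚ; _/_)
open import Data.Fin.Base as Fin using (Fin)
open import Data.Fin.Properties as Fin using (all?)
open import Data.Bool.Base using (if_then_else_)
open import Data.List.Base as List using (List; allFin; cartesianProductWith; filter; length)
open import Data.Product.Base using (_×_)
open import Data.Vec.Base using (Vec; []; _∷_; lookup)
open import Data.Vec.Relation.Unary.AllPairs using (allPairs?)
open import Data.Vec.Relation.Unary.Unique.Propositional using (Unique)
open import Relation.Binary.Definitions using (tri<; tri≈; tri>)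
open import Relation.Binary.PropositionalEquality using (_≡_; _≢_)
open import Relation.Nullary.Decidable using (Dec; does; ¬?; _×-dec_)

-- Words a₁⋯aₗ of length l over an m-letter alphabet, each listed once.
-- Letters and positions are numbered from 0, so Fin m stands for {1,…,m}.
words : (m l : ℕ) → List (Vec (Fin m) l)
words m zero    = [] List.∷ List.[]
words m (suc l) = cartesianProductWith _∷_ (allFin m) (words m l)

IsPermutation : ∀ {m} → Vec (Fin m) m → Set
IsPermutation π = Unique π

IsFPFInvolution : ∀ {m} → Vec (Fin m) m → Set
IsFPFInvolution π =
  IsPermutation π × (∀ i → lookup π (lookup π i) ≡ i) × (∀ i → lookup π i ≢ i)

isFPFInvolution? : ∀ {m} (π : Vec (Fin m) m) → Dec (IsFPFInvolution π)
isFPFInvolution? π =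
  allPairs? (λ x y → ¬? (x Fin.≟ y)) π
  ×-dec all? (λ i → lookup π (lookup π i) Fin.≟ i)
  ×-dec all? (λ i → ¬? (lookup π i Fin.≟ i))

des : ∀ {m l} → Vec (Fin m) l → ℕ
des []           = 0
des (x ∷ [])     = 0
des (x ∷ y ∷ xs) = (if does (y Fin.<? x) then 1 else 0) ℕ.+ des (y ∷ xs)

J : (m j : ℕ) → ℕ
J m j = length (filter (λ π → isFPFInvolution? π ×-dec (des π ℕ.≟ j)) (words m m))

-- Σ[1≤i≤ n ] f = f 1 + ⋯ + f n
Σ[1≤i≤_] : ℕ → (ℕ → ℚ) → ℚ
Σ[1≤i≤ zero  ] f = 0ℚ
Σ[1≤i≤ suc n ] f = Σ[1≤i≤ n ] f ℚ.+ f (suc n)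

-- Quotient of naturals in ℚ. The value at denominator 0 is junk and is never
-- used in b below: its denominators 2m - j - i are positive.
quot : ℕ → ℕ → ℚ
quot p zero    = 0ℚ
quot p (suc q) = + p / suc q

-- (-1)^(j-i) (2m-2i)/(2m-j-i) C(2m-j-i, j-i) J_{2m,i}. It is only used with
-- i ≤ j ≤ m, where no subtraction is truncated.
term : (m j i : ℕ) → ℚ
term m j i =
  ((-1ℤ ℤ.^ (j ∸ i)) / 1)
  ℚ.* quot (2 ℕ.* m ∸ 2 ℕ.* i) (2 ℕ.* m ∸ j ∸ i)
  ℚ.* (+ ((2 ℕ.* m ∸ j ∸ i) C (j ∸ i)) / 1)
  ℚ.* (+ J (2 ℕ.* m) i / 1)

-- b m j is b_{2m,j}: the first index is half of the one in the usual notation.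
-- The second index is an integer, and b m j = 0 for j < 1 and for j > m.
b : ℕ → ℤ → ℚ
b m -[1+ _ ]  = 0ℚ
b m (+ zero)  = 0ℚ
b m (+ suc j) with <-cmp (suc j) m
... | tri< _ _ _ = Σ[1≤i≤ suc j ] (term m (suc j))
... | tri≈ _ _ _ = (+ J (2 ℕ.* m) (suc j) / 1) ℚ.+ Σ[1≤i≤ j ] (term m (suc j))
... | tri> _ _ _ = 0ℚ

{-# OPTIONS --safe #-}
module Submission where

open import Defs
open import Data.Fin.Base as Fin using (Fin; toℕ; fromℕ<; punchIn; punchOut)
import Data.Fin.Properties as Fin
open import Data.Bool.Base using (true; false; if_then_else_)
open import Data.Integer.Base as ℤ using (ℤ; +_; -[1+_]; _+_; _*_; _-_; -_; _^_; 0ℤ; 1ℤ; -1ℤ)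
import Data.Integer.Properties as ℤ
open import Data.Integer.Tactic.RingSolver using (solve-∀)
open import Data.List.Base as List using (List; []; _∷_; _++_; allFin; filter; length; cartesianProduct)
import Data.List.Properties as List
open import Data.List.Membership.Propositional using (_∈_)
open import Data.List.Membership.Propositional.Properties
  using (∈-map⁺; ∈-map⁻; ∈-filter⁺; ∈-filter⁻; ∈-allFin; ∈-cartesianProduct⁺; ∈-cartesianProduct⁻; ∈-cartesianProductWith⁺)
open import Data.List.Membership.Propositional.Properties.WithK using (unique∧set⇒bag)
open import Data.List.Relation.Binary.BagAndSetEquality using (∼bag⇒↭)
open import Data.List.Relation.Binary.Permutation.Propositional as ↭ using (_↭_)
open import Data.List.Relation.Unary.All using ([])
open import Data.List.Relation.Unary.AllPairs using ([]; _∷_)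
open import Data.List.Relation.Unary.Any using (here; there)
import Data.List.Relation.Unary.Unique.Propositional as List
import Data.List.Relation.Unary.Unique.Propositional.Properties as ListUnique
open import Data.Nat.Base as ℕ using (ℕ; zero; suc; _∸_; _≤_; _<_; z≤n; s≤s; _!)
open import Data.Nat.Combinatorics using (_C_; nCk≡n!/k![n-k]!; k![n∸k]!∣n!; nCn≡1; nC1≡n)
open import Data.Nat.DivMod using (m/n*n≡m)
import Data.Nat.Properties as ℕ
open import Data.Product.Base using (_×_; _,_; proj₁; proj₂; ∃)
open import Data.Product.Properties using (,-injective)
open import Data.Rational.Base as ℚ using (ℚ; 0ℚ; _/_; fromℚᵘ)
import Data.Rational.Properties as ℚ
open import Data.Rational.Unnormalised.Base as ℚᵘ using (mkℚᵘ; *≡*)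
import Data.Rational.Unnormalised.Properties as ℚᵘ
open import Data.Sum.Base using (_⊎_; inj₁; inj₂)
open import Data.Vec.Base as Vec using (Vec; []; _∷_; lookup; map; insertAt)
import Data.Vec.Properties as Vec
import Data.Vec.Relation.Unary.Unique.Propositional as Vec
import Data.Vec.Relation.Unary.Unique.Propositional.Properties as VecUnique
open import Function.Base using (_∘_; id; const)
open import Function.Bundles using (mk⇔)
open import Relation.Binary.Definitions using (tri<; tri≈; tri>)
open import Relation.Binary.PropositionalEquality
  using (_≡_; _≢_; refl; sym; trans; cong; cong₂; subst; ≢-sym; module ≡-Reasoning)
open import Relation.Nullary.Decidable using (Dec; yes; no; does; _×-dec_)
open import Relation.Nullary.Negation using (¬_; contradiction)

-- Adding a cycle to a fixed-point free involution π of {1,…,M} with d descents amounts to choosing the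
-- gaps p, q ∈ {0,…,M} of its two letters. Put π(0) = 0 and π(M+1) = M+1, and let Z(p,q) = 1 when q lies in
-- the cyclic interval [π(p), π(p+1)) of ℤ/(M+1), and 0 otherwise. The number of descents grows by
-- 2 - Z(p,q) - Z(q,p) if p ≠ q, and by 2 - Z(p,p) if p = q. Since Z(p,q) is [π(p) ≤ q] - [π(p+1) ≤ q] plus
-- the indicator of a descent at p, summation by parts and π² = id evaluate Σ Z(p,q) Z(q,p) and Σ Z(p,p) in
-- terms of M and d only. So the distribution of descents over all insertions depends on π only through d,
-- which gives a three-term recurrence for J_{2n,k}, and with it the symmetry J_{2n,k} = J_{2n,2n-k}.
-- As b_{2n,k} = Σ_p (-1)^p L(2n-2k, p) J_{2n,k-p} with Lucas coefficients L, the recurrence for b reduces to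
-- an identity between L(s,p), L(s,p-1), L(s,p-2), L(s-2,p) and L(s+2,p-2), in which factorials cancel.

-- Indicators and sums

-- The factor 2n comes from marking: a larger involution together with one marked position arises
-- from exactly one insertion. The (M+1)(M+2) insertions are the (M+1)² pairs of gaps with every
-- diagonal pair taken twice, because two letters sharing a gap form a cycle of neighbours and
-- either of them can carry the mark. The signs and quotients in b come from the classical formula 1
-- + t^r = Σ_p (-1)^p r/(r-p) C(r-p,p) t^p (1+t)^(r-2p), applied to t^i + t^(2m-i) with r = 2m - 2i.
-- The exponent of 1 + t is the first argument of L. The middle power t^m has no partner, so it
-- needs the coefficient 1, which is the value chosen for L(0,0). The obstacle is k = n: there
-- L(2n-2-2k, p) would have first argument -2, and only there does the symmetry of J enter. All
-- identities are proved over ℤ, with J indexed by integers so that shifts by 1 and 2 cause no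
-- boundary cases; rational numbers appear only at the end.

⟦_⟧ : ∀ {ℓ} {P : Set ℓ} → Dec P → ℤ
⟦ P? ⟧ = if does P? then 1ℤ else 0ℤ

⟦⟧-true : ∀ {ℓ} {P : Set ℓ} (P? : Dec P) → P → ⟦ P? ⟧ ≡ 1ℤ
⟦⟧-true (yes _) _ = refl
⟦⟧-true (no ¬p) p = contradiction p ¬p

⟦⟧-false : ∀ {ℓ} {P : Set ℓ} (P? : Dec P) → ¬ P → ⟦ P? ⟧ ≡ 0ℤ
⟦⟧-false (yes p) ¬p = contradiction p ¬p
⟦⟧-false (no _)  _  = refl

⟦⟧-cong : ∀ {ℓ ℓ′} {P : Set ℓ} {Q : Set ℓ′} (P? : Dec P) (Q? : Dec Q) → (P → Q) → (Q → P) → ⟦ P? ⟧ ≡ ⟦ Q? ⟧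
⟦⟧-cong (yes p) Q? to _    = sym (⟦⟧-true Q? (to p))
⟦⟧-cong (no ¬p) Q? _  from = sym (⟦⟧-false Q? (¬p ∘ from))

⟦⟧-complement : ∀ {ℓ ℓ′} {P : Set ℓ} {Q : Set ℓ′} (P? : Dec P) (Q? : Dec Q) → (Q → ¬ P) → (¬ Q → P) → ⟦ P? ⟧ ≡ 1ℤ - ⟦ Q? ⟧
⟦⟧-complement P? (yes q) to _    = ⟦⟧-false P? (to q)
⟦⟧-complement P? (no ¬q) _  from = ⟦⟧-true P? (from ¬q)

-- Raising the threshold costs a point mass. In `trace` and `abel` this makes the threshold move
-- together with the other index, so that one part telescopes and the other picks out single terms.
≤-suc-split : ∀ x p → ⟦ x ℕ.≤? p ⟧ ≡ ⟦ x ℕ.≤? suc p ⟧ - ⟦ x ℕ.≟ suc p ⟧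
≤-suc-split x p with ℕ.<-cmp x (suc p)
... | tri< x<1+p x≢1+p _ = begin
  ⟦ x ℕ.≤? p ⟧                          ≡⟨ ⟦⟧-true (x ℕ.≤? p) (ℕ.s≤s⁻¹ x<1+p) ⟩
  1ℤ - 0ℤ                               ≡⟨ cong₂ _-_ (⟦⟧-true (x ℕ.≤? suc p) (ℕ.<⇒≤ x<1+p)) (⟦⟧-false (x ℕ.≟ suc p) x≢1+p) ⟨
  ⟦ x ℕ.≤? suc p ⟧ - ⟦ x ℕ.≟ suc p ⟧    ∎
  where open ≡-Reasoning
... | tri≈ x≮1+p refl _ = begin
  ⟦ x ℕ.≤? p ⟧                          ≡⟨ ⟦⟧-false (x ℕ.≤? p) ℕ.1+n≰n ⟩
  1ℤ - 1ℤ                               ≡⟨ cong₂ _-_ (⟦⟧-true (x ℕ.≤? x) ℕ.≤-refl) (⟦⟧-true (x ℕ.≟ x) refl) ⟨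
  ⟦ x ℕ.≤? suc p ⟧ - ⟦ x ℕ.≟ suc p ⟧    ∎
  where open ≡-Reasoning
... | tri> _ x≢1+p x>1+p = begin
  ⟦ x ℕ.≤? p ⟧                          ≡⟨ ⟦⟧-false (x ℕ.≤? p) (λ x≤p → ℕ.<⇒≱ x>1+p (ℕ.m≤n⇒m≤1+n x≤p)) ⟩
  0ℤ - 0ℤ                               ≡⟨ cong₂ _-_ (⟦⟧-false (x ℕ.≤? suc p) (ℕ.<⇒≱ x>1+p)) (⟦⟧-false (x ℕ.≟ suc p) x≢1+p) ⟨
  ⟦ x ℕ.≤? suc p ⟧ - ⟦ x ℕ.≟ suc p ⟧    ∎
  where open ≡-Reasoning

∑ : ℕ → (ℕ → ℤ) → ℤ
∑ zero    f = 0ℤ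
∑ (suc n) f = ∑ n f + f n

syntax ∑ n (λ p → e) = ∑[ p < n ] e
infix 10 ∑

∑-cong : ∀ n {f g : ℕ → ℤ} → (∀ {p} → p < n → f p ≡ g p) → ∑ n f ≡ ∑ n g
∑-cong zero    f≗g = refl
∑-cong (suc n) f≗g = cong₂ _+_ (∑-cong n (f≗g ∘ ℕ.m<n⇒m<1+n)) (f≗g ℕ.≤-refl)

∑-+ : ∀ n (f g : ℕ → ℤ) → ∑[ p < n ] (f p + g p) ≡ ∑ n f + ∑ n g
∑-+ zero    f g = refl
∑-+ (suc n) f g = trans (cong (_+ (f n + g n)) (∑-+ n f g)) (interchange (∑ n f) (∑ n g) (f n) (g n))
  where
  interchange : ∀ a b c d → a + b + (c + d) ≡ a + c + (b + d)
  interchange = solve-∀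

∑-*ˡ : ∀ n c (f : ℕ → ℤ) → ∑[ p < n ] (c * f p) ≡ c * ∑ n f
∑-*ˡ zero    c f = sym (ℤ.*-zeroʳ c)
∑-*ˡ (suc n) c f = trans (cong (_+ c * f n) (∑-*ˡ n c f)) (sym (ℤ.*-distribˡ-+ c (∑ n f) (f n)))

∑-*ʳ : ∀ n c (f : ℕ → ℤ) → ∑[ p < n ] (f p * c) ≡ ∑ n f * c
∑-*ʳ n c f = trans (∑-cong n (λ {p} _ → ℤ.*-comm (f p) c)) (trans (∑-*ˡ n c f) (ℤ.*-comm c (∑ n f)))

∑-const : ∀ n c → ∑[ p < n ] c ≡ + n * c
∑-const zero    c = refl
∑-const (suc n) c = trans (cong (_+ c) (∑-const n c)) (step (+ n) c)
  where
  step : ∀ m c → m * c + c ≡ (1ℤ + m) * c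
  step = solve-∀

∑-zero : ∀ n {f} → (∀ {p} → p < n → f p ≡ 0ℤ) → ∑ n f ≡ 0ℤ
∑-zero n f≗0 = trans (∑-cong n f≗0) (trans (∑-const n 0ℤ) (ℤ.*-zeroʳ (+ n)))

∑-front : ∀ n f → ∑ (suc n) f ≡ f 0 + ∑ n (f ∘ suc)
∑-front zero    f = ℤ.+-comm 0ℤ (f 0)
∑-front (suc n) f = trans (cong (_+ f (suc n)) (∑-front n f)) (ℤ.+-assoc (f 0) _ _)

∑-telescope : ∀ n (f : ℕ → ℤ) → ∑[ p < n ] (f p - f (suc p)) ≡ f 0 - f n
∑-telescope zero    f = sym (ℤ.+-inverseʳ (f 0))
∑-telescope (suc n) f = trans (cong (_+ (f n - f (suc n))) (∑-telescope n f)) (step (f 0) (f n) (f (suc n)))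
  where
  step : ∀ a b c → a - b + (b - c) ≡ a - c
  step = solve-∀

∑-swap : ∀ m n (f : ℕ → ℕ → ℤ) → ∑[ p < m ] (∑[ q < n ] (f p q)) ≡ ∑[ q < n ] (∑[ p < m ] (f p q))
∑-swap zero    n f = sym (∑-zero n (λ _ → refl))
∑-swap (suc m) n f = trans (cong (_+ ∑ n (f m)) (∑-swap m n f)) (sym (∑-+ n (λ q → ∑[ p < m ] (f p q)) (f m)))

∑-single : ∀ n {q f} → q < n → (∀ {p} → p < n → p ≢ q → f p ≡ 0ℤ) → ∑ n f ≡ f q
∑-single (suc n) {q} {f} q<1+n f≗0 with ℕ.m<1+n⇒m<n∨m≡n q<1+n
... | inj₂ refl = trans (cong (_+ f n) (∑-zero n (λ p<n → f≗0 (ℕ.m<n⇒m<1+n p<n) (ℕ.<⇒≢ p<n)))) (ℤ.+-identityˡ (f n))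
... | inj₁ q<n  = trans (cong₂ _+_ (∑-single n q<n (λ p<n → f≗0 (ℕ.m<n⇒m<1+n p<n))) (f≗0 ℕ.≤-refl (≢-sym (ℕ.<⇒≢ q<n)))) (ℤ.+-identityʳ (f q))

-- The map sending i ≤ q to i and i > q to i - 1 takes every value p < n once, except q twice.
∑-pinch : ∀ n {q} (f k : ℕ → ℤ) → q < n →
  (∀ {p} → p < q → f p ≡ k p) → (∀ {p} → q < p → p < n → f (suc p) ≡ k p) →
  ∑ (suc n) f ≡ ∑ n k + (f q + f (suc q) - k q)
∑-pinch (suc n) {q} f k q<1+n below above with ℕ.m<1+n⇒m<n∨m≡n q<1+n
... | inj₂ refl = trans (cong (λ s → s + f n + f (suc n)) (∑-cong n below)) (step (∑ n k) (f n) (f (suc n)) (k n))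
  where
  step : ∀ s a b c → s + a + b ≡ s + c + (a + b - c)
  step = solve-∀
... | inj₁ q<n  = trans (cong₂ _+_ (∑-pinch n f k q<n below (λ q<p p<n → above q<p (ℕ.m<n⇒m<1+n p<n))) (above q<n ℕ.≤-refl))
                        (step (∑ n k) (f q + f (suc q) - k q) (k n))
  where
  step : ∀ s e b → s + e + b ≡ s + b + e
  step = solve-∀

-- Sums over pairs of gaps

module GapCount (M : ℕ) (a : ℕ → ℕ)
  (a-0 : a 0 ≡ 0) (a-top : a (suc M) ≡ suc M)
  (a-bounded : ∀ {p} → p ≤ suc M → a p ≤ suc M)
  (a-involutive : ∀ {p} → p ≤ suc M → a (a p) ≡ p)
  (a-fixpoint-free : ∀ {p} → 0 < p → p ≤ M → a p ≢ p) where

  H X Z : ℕ → ℕ → ℤ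
  D : ℕ → ℤ

  H p q = ⟦ a p ℕ.≤? q ⟧
  X p q = H p q - H (suc p) q
  D p   = ⟦ a (suc p) ℕ.<? a p ⟧
  Z p q = X p q + D p

  d : ℤ
  d = ∑ (suc M) D

  -- The values 2 and -1 would need a descent with a p ≤ q < a (p+1), or a non-descent with a (p+1)
  -- ≤ q < a p; both are impossible.
  Z-binary : ∀ p q → Z p q ≡ 0ℤ ⊎ Z p q ≡ 1ℤ
  Z-binary p q = binary (a p ℕ.≤? q) (a (suc p) ℕ.≤? q) (a (suc p) ℕ.<? a p)
    (λ r<l l≤q → ℕ.≤-trans (ℕ.<⇒≤ r<l) l≤q) (λ r≮l r≤q → ℕ.≤-trans (ℕ.≮⇒≥ r≮l) r≤q)
    where
    binary : ∀ {A B C : Set} (A? : Dec A) (B? : Dec B) (C? : Dec C) → (C → A → B) → (¬ C → B → A) →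
      let z = ⟦ A? ⟧ - ⟦ B? ⟧ + ⟦ C? ⟧ in z ≡ 0ℤ ⊎ z ≡ 1ℤ
    binary (yes a) (no ¬b) (yes c) f g = contradiction (f c a) ¬b
    binary (no ¬a) (yes b) (no ¬c) f g = contradiction (g ¬c b) ¬a
    binary (yes _) (yes _) (yes _) f g = inj₂ refl
    binary (yes _) (yes _) (no _)  f g = inj₁ refl
    binary (yes _) (no _)  (no _)  f g = inj₂ refl
    binary (no _)  (yes _) (yes _) f g = inj₁ refl
    binary (no _)  (no _)  (yes _) f g = inj₂ refl
    binary (no _)  (no _)  (no _)  f g = inj₁ refl

  Z-idem : ∀ p q → Z p q * Z p q ≡ Z p q
  Z-idem p q with Z p q | Z-binary p q
  ... | _ | inj₁ refl = refl
  ... | _ | inj₂ refl = refl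

  H-0 : ∀ q → H 0 q ≡ 1ℤ
  H-0 q = ⟦⟧-true (a 0 ℕ.≤? q) (subst (_≤ q) (sym a-0) z≤n)

  H-top : ∀ {q} → q ≤ M → H (suc M) q ≡ 0ℤ
  H-top {q} q≤M = ⟦⟧-false (a (suc M) ℕ.≤? q) (λ a≤q → ℕ.<⇒≱ (s≤s q≤M) (subst (_≤ q) a-top a≤q))

  a-pos : ∀ {p} → 0 < p → p ≤ suc M → 0 < a p
  a-pos {p} 0<p p≤1+M = ℕ.n≢0⇒n>0 (λ ap≡0 → ℕ.<⇒≢ 0<p (trans (sym a-0) (trans (sym (cong a ap≡0)) (a-involutive p≤1+M))))

  H-pos-0 : ∀ {p} → 0 < p → p ≤ suc M → H p 0 ≡ 0ℤ
  H-pos-0 {p} 0<p p≤1+M = ⟦⟧-false (a p ℕ.≤? 0) (ℕ.<⇒≱ (a-pos 0<p p≤1+M))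

  column : ∀ {q} → q ≤ M → ∑[ p < suc M ] (X p q) ≡ 1ℤ
  column {q} q≤M = trans (∑-telescope (suc M) (λ p → H p q)) (cong₂ _-_ (H-0 q) (H-top q≤M))

  -- Along the diagonal the telescoping part is 1 - 1 = 0. What remains counts the fixed points of
  -- `a` in {1,...,M+1}, and the sentinel M+1 is the only one.
  trace : ∑[ p < suc M ] (X p p) ≡ 1ℤ
  trace = begin
    ∑[ p < suc M ] (X p p)
      ≡⟨ ∑-cong (suc M) (λ {p} _ → trans (cong (λ h → H p p - h) (≤-suc-split (a (suc p)) p)) (regroup (H p p) (H (suc p) (suc p)) (E p))) ⟩
    ∑[ p < suc M ] ((H p p - H (suc p) (suc p)) + E p)
      ≡⟨ ∑-+ (suc M) (λ p → H p p - H (suc p) (suc p)) E ⟩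
    ∑[ p < suc M ] (H p p - H (suc p) (suc p)) + ∑ (suc M) E
      ≡⟨ cong₂ _+_ (∑-telescope (suc M) (λ p → H p p)) (∑-single (suc M) ℕ.≤-refl E-inner) ⟩
    H 0 0 - H (suc M) (suc M) + E M
      ≡⟨ cong₂ _+_ (cong₂ _-_ (H-0 0) (⟦⟧-true (a (suc M) ℕ.≤? suc M) (ℕ.≤-reflexive a-top))) (⟦⟧-true (a (suc M) ℕ.≟ suc M) a-top) ⟩
    1ℤ ∎
    where
    open ≡-Reasoning
    E : ℕ → ℤ
    E p = ⟦ a (suc p) ℕ.≟ suc p ⟧
    E-inner : ∀ {p} → p < suc M → p ≢ M → E p ≡ 0ℤ
    E-inner {p} p<1+M p≢M = ⟦⟧-false (a (suc p) ℕ.≟ suc p) (a-fixpoint-free (s≤s z≤n) (ℕ.≤∧≢⇒< (ℕ.s≤s⁻¹ p<1+M) p≢M))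
    regroup : ∀ h k e → h - (k - e) ≡ h - k + e
    regroup = solve-∀

  -- Abel summation: the boundary terms telescope, and what is left picks out the p with suc p ≡ a r.
  abel : ∀ {r q} → r ≤ suc M → ∑[ p < suc M ] (X p q * H r p) ≡
    ⟦ a r ℕ.≤? 0 ⟧ - H (suc M) q * H r (suc M) + ⟦ 0 ℕ.<? a r ⟧ * ⟦ r ℕ.≤? q ⟧
  abel {r} {q} r≤1+M = begin
    ∑[ p < suc M ] (X p q * H r p)
      ≡⟨ ∑-cong (suc M) (λ {p} _ → trans (expand (H p q) (H (suc p) q) (H r p))
          (trans (cong (λ h → H p q * H r p - H (suc p) q * h) (≤-suc-split (a r) p))
          (regroup (H p q * H r p) (H (suc p) q) (H r (suc p)) ⟦ a r ℕ.≟ suc p ⟧))) ⟩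
    ∑[ p < suc M ] ((F p - F (suc p)) + G p)
      ≡⟨ ∑-+ (suc M) (λ p → F p - F (suc p)) G ⟩
    ∑[ p < suc M ] (F p - F (suc p)) + ∑ (suc M) G
      ≡⟨ cong₂ _+_ (∑-telescope (suc M) F) ∑G ⟩
    H 0 q * H r 0 - F (suc M) + ⟦ 0 ℕ.<? a r ⟧ * ⟦ r ℕ.≤? q ⟧
      ≡⟨ cong (λ h → h - F (suc M) + ⟦ 0 ℕ.<? a r ⟧ * ⟦ r ℕ.≤? q ⟧) (trans (cong (_* H r 0) (H-0 q)) (ℤ.*-identityˡ (H r 0))) ⟩
    ⟦ a r ℕ.≤? 0 ⟧ - F (suc M) + ⟦ 0 ℕ.<? a r ⟧ * ⟦ r ℕ.≤? q ⟧ ∎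
    where
    open ≡-Reasoning
    F G : ℕ → ℤ
    F p = H p q * H r p
    G p = H (suc p) q * ⟦ a r ℕ.≟ suc p ⟧
    expand : ∀ h k e → (h - k) * e ≡ h * e - k * e
    expand = solve-∀
    regroup : ∀ g k h e → g - k * (h - e) ≡ g - k * h + k * e
    regroup = solve-∀
    G-zero : ∀ {p} → a r ≢ suc p → G p ≡ 0ℤ
    G-zero {p} ne = trans (cong (H (suc p) q *_) (⟦⟧-false (a r ℕ.≟ suc p) ne)) (ℤ.*-zeroʳ (H (suc p) q))
    ∑G′ : ∀ x → a r ≡ x → ∑ (suc M) G ≡ ⟦ 0 ℕ.<? x ⟧ * ⟦ r ℕ.≤? q ⟧
    ∑G′ zero    ar≡0 = trans (∑-zero (suc M) (λ _ → G-zero (λ ar≡1+p → ℕ.0≢1+n (trans (sym ar≡0) ar≡1+p)))) refl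
    ∑G′ (suc x) ar≡1+x = begin
      ∑ (suc M) G                            ≡⟨ ∑-single (suc M) (subst (_≤ suc M) ar≡1+x (a-bounded r≤1+M))
          (λ _ p≢x → G-zero (λ ar≡1+p → p≢x (ℕ.suc-injective (trans (sym ar≡1+p) ar≡1+x)))) ⟩
      H (suc x) q * ⟦ a r ℕ.≟ suc x ⟧        ≡⟨ cong (λ e → H (suc x) q * e) (⟦⟧-true (a r ℕ.≟ suc x) ar≡1+x) ⟩
      -- Involutivity enters here: at the surviving index a r the entry compares a (a r) = r with q.
      H (suc x) q * 1ℤ                       ≡⟨ ℤ.*-comm (H (suc x) q) 1ℤ ⟩
      1ℤ * ⟦ a (suc x) ℕ.≤? q ⟧              ≡⟨ cong (λ y → 1ℤ * ⟦ y ℕ.≤? q ⟧) (trans (cong a (sym ar≡1+x)) (a-involutive r≤1+M)) ⟩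
      1ℤ * ⟦ r ℕ.≤? q ⟧                      ∎
    ∑G : ∑ (suc M) G ≡ ⟦ 0 ℕ.<? a r ⟧ * ⟦ r ℕ.≤? q ⟧
    ∑G = ∑G′ (a r) refl

  -- After `abel`, the row of r matters only through [r ≤ q]. So r = q contributes 1 and r = q + 1
  -- contributes 0, for every q. For q = 0 the 1 comes from the boundary term instead, as a 0 = 0.
  square-column : ∀ {q} → q ≤ M → ∑[ p < suc M ] (X p q * X q p) ≡ 1ℤ
  square-column {q} q≤M = begin
    ∑[ p < suc M ] (X p q * X q p)
      ≡⟨ ∑-cong (suc M) (λ {p} _ → expand (X p q) (H q p) (H (suc q) p)) ⟩
    ∑[ p < suc M ] (X p q * H q p + - 1ℤ * (X p q * H (suc q) p))
      ≡⟨ trans (∑-+ (suc M) (λ p → X p q * H q p) (λ p → - 1ℤ * (X p q * H (suc q) p)))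
          (cong (λ s → ∑[ p < suc M ] (X p q * H q p) + s) (∑-*ˡ (suc M) (- 1ℤ) (λ p → X p q * H (suc q) p))) ⟩
    ∑[ p < suc M ] (X p q * H q p) + - 1ℤ * (∑[ p < suc M ] (X p q * H (suc q) p))
      ≡⟨ cong₂ (λ s t → s + - 1ℤ * t) (abel (ℕ.m≤n⇒m≤1+n q≤M)) (abel (s≤s q≤M)) ⟩
    (⟦ a q ℕ.≤? 0 ⟧ - H (suc M) q * H q (suc M) + ⟦ 0 ℕ.<? a q ⟧ * ⟦ q ℕ.≤? q ⟧)
      + - 1ℤ * (⟦ a (suc q) ℕ.≤? 0 ⟧ - H (suc M) q * H (suc q) (suc M) + ⟦ 0 ℕ.<? a (suc q) ⟧ * ⟦ suc q ℕ.≤? q ⟧)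
      ≡⟨ simplify {⟦ a q ℕ.≤? 0 ⟧} {⟦ 0 ℕ.<? a q ⟧} {k = H q (suc M)} {s = H (suc q) (suc M)} {v′ = ⟦ 0 ℕ.<? a
          (suc q) ⟧} {c = ⟦ suc q ℕ.≤? q ⟧} (H-top q≤M) (⟦⟧-true (q ℕ.≤? q) ℕ.≤-refl) (H-pos-0 (s≤s z≤n) (s≤s q≤M))
          (⟦⟧-false (suc q ℕ.≤? q) ℕ.1+n≰n) ⟩
    ⟦ a q ℕ.≤? 0 ⟧ + ⟦ 0 ℕ.<? a q ⟧
      ≡⟨ dichotomy (a q) ⟩
    1ℤ ∎
    where
    open ≡-Reasoning
    expand : ∀ x h k → x * (h - k) ≡ x * h + - 1ℤ * (x * k)
    expand = solve-∀
    dichotomy : ∀ x → ⟦ x ℕ.≤? 0 ⟧ + ⟦ 0 ℕ.<? x ⟧ ≡ 1ℤ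
    dichotomy zero    = refl
    dichotomy (suc x) = refl
    simplify : ∀ {u v h k t w s v′ c} → h ≡ 0ℤ → t ≡ 1ℤ → w ≡ 0ℤ → c ≡ 0ℤ →
      (u - h * k + v * t) + - 1ℤ * (w - h * s + v′ * c) ≡ u + v
    simplify {u} {v} {k = k} {s = s} {v′ = v′} refl refl refl refl = lem u v k s v′
      where
      lem : ∀ u v k s v′ → (u - 0ℤ * k + v * 1ℤ) + - 1ℤ * (0ℤ - 0ℤ * s + v′ * 0ℤ) ≡ u + v
      lem = solve-∀

  module Insertions (Φ : ℤ → ℤ) where

    -- `e` and `c` are first and second differences of Φ. For bits x and y they give Φ(d+2-x-y) = φ₂
    -- + (x+y)e + xyc, so every statistic of the insertions is determined by the sums of Z(p,q), of
    -- Z(p,q)Z(q,p) and of Z(q,q).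
    φ₀ φ₁ φ₂ e c N : ℤ
    φ₀ = Φ d
    φ₁ = Φ (d + 1ℤ)
    φ₂ = Φ (d + + 2)
    e  = φ₁ - φ₂
    c  = φ₀ - + 2 * φ₁ + φ₂
    N  = + suc M

    K : ℕ → ℕ → ℤ
    K p q = Φ (d + + 2 - Z p q - Z q p)

    K-diag : ℕ → ℤ
    K-diag q = Φ (d + + 2 - Z q q)

    linear : ∀ {x} → x ≡ 0ℤ ⊎ x ≡ 1ℤ → Φ (d + + 2 - x) ≡ φ₂ + x * e
    linear (inj₁ refl) = trans (cong Φ (shift d)) (value φ₂ e)
      where
      shift : ∀ d → d + + 2 - 0ℤ ≡ d + + 2
      shift = solve-∀
      value : ∀ u v → u ≡ u + 0ℤ * v
      value = solve-∀
    linear (inj₂ refl) = trans (cong Φ (shift d)) (value φ₁ φ₂)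
      where
      shift : ∀ d → d + + 2 - 1ℤ ≡ d + 1ℤ
      shift = solve-∀
      value : ∀ u v → u ≡ v + 1ℤ * (u - v)
      value = solve-∀

    bilinear : ∀ {x y} → x ≡ 0ℤ ⊎ x ≡ 1ℤ → y ≡ 0ℤ ⊎ y ≡ 1ℤ →
      Φ (d + + 2 - x - y) ≡ φ₂ + x * e + y * e + x * y * c
    bilinear {y = y} (inj₁ refl) y-binary = trans (cong Φ (shift d y)) (trans (linear y-binary) (value φ₂ e c y))
      where
      shift : ∀ d y → d + + 2 - 0ℤ - y ≡ d + + 2 - y
      shift = solve-∀
      value : ∀ u v w y → u + y * v ≡ u + 0ℤ * v + y * v + 0ℤ * y * w
      value = solve-∀
    bilinear {x} (inj₂ refl) (inj₁ refl) = trans (cong Φ (shift d)) (value φ₁ φ₂ c)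
      where
      shift : ∀ d → d + + 2 - 1ℤ - 0ℤ ≡ d + 1ℤ
      shift = solve-∀
      value : ∀ u v w → u ≡ v + 1ℤ * (u - v) + 0ℤ * (u - v) + 1ℤ * 0ℤ * w
      value = solve-∀
    bilinear (inj₂ refl) (inj₂ refl) = trans (cong Φ (shift d)) (value φ₀ φ₁ φ₂)
      where
      shift : ∀ d → d + + 2 - 1ℤ - 1ℤ ≡ d
      shift = solve-∀
      value : ∀ u v w → u ≡ w + 1ℤ * (v - w) + 1ℤ * (v - w) + 1ℤ * 1ℤ * (u - + 2 * v + w)
      value = solve-∀

    -- `row q` and `R q` vary with q, so a single column sum of K is not yet determined by d. Only
    -- their totals over q are needed, and exchanging the sums reduces these to the columns of X,
    -- each of which sums to 1.
    row R S : ℕ → ℤ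
    row q = ∑[ p < suc M ] (X q p)
    R q   = ∑[ p < suc M ] (D p * X q p)
    S q   = N * φ₂ + (1ℤ + d) * e + (row q + N * D q) * e + (1ℤ + D q + R q + d * D q) * c

    ∑row : ∑ (suc M) row ≡ N
    ∑row = begin
      ∑ (suc M) row                                   ≡⟨ ∑-swap (suc M) (suc M) X ⟩
      ∑[ p < suc M ] (∑[ q < suc M ] (X q p))          ≡⟨ ∑-cong (suc M) (λ p≤M → column (ℕ.s≤s⁻¹ p≤M)) ⟩
      ∑[ p < suc M ] 1ℤ                                ≡⟨ trans (∑-const (suc M) 1ℤ) (ℤ.*-identityʳ N) ⟩
      N                                               ∎
      where open ≡-Reasoning

    ∑R : ∑ (suc M) R ≡ d
    ∑R = begin
      ∑ (suc M) R                                           ≡⟨ ∑-swap (suc M) (suc M) (λ q p → D p * X q p) ⟩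
      ∑[ p < suc M ] (∑[ q < suc M ] (D p * X q p))          ≡⟨ ∑-cong (suc M)
          (λ {p} p≤M → trans (∑-*ˡ (suc M) (D p) (λ q → X q p)) (trans (cong (D p *_) (column (ℕ.s≤s⁻¹ p≤M)))
          (ℤ.*-identityʳ (D p)))) ⟩
      d                                                     ∎
      where open ≡-Reasoning

    K-column : ∀ {q} → q ≤ M → ∑[ p < suc M ] (K p q) ≡ S q
    K-column {q} q≤M = begin
      ∑[ p < suc M ] (K p q)
        ≡⟨ ∑-cong (suc M) (λ {p} _ → trans (bilinear (Z-binary p q) (Z-binary q p)) (expand φ₂ e c (X p q) (D p) (X q p) (D q))) ⟩
      ∑[ p < suc M ] (φ₂ + D q * e + (X p q + D p) * e + X q p * e + (X p q * X q p + X p q * D q + D p * X q p + D p * D q) * c)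
        ≡⟨ ∑-+ (suc M) _ _ ⟩
      ∑[ p < suc M ] (φ₂ + D q * e + (X p q + D p) * e + X q p * e) + ∑[ p < suc M ] ((X p q * X q p + X p q * D q + D p * X q p + D p * D q) * c)
        ≡⟨ cong₂ _+_ first second ⟩
      N * (φ₂ + D q * e) + (1ℤ + d) * e + row q * e + (1ℤ + 1ℤ * D q + R q + d * D q) * c
        ≡⟨ collect N φ₂ e c d (D q) (row q) (R q) ⟩
      S q ∎
      where
      open ≡-Reasoning
      expand : ∀ φ e c x d y d′ → φ + (x + d) * e + (y + d′) * e + (x + d) * (y + d′) * c ≡
        φ + d′ * e + (x + d) * e + y * e + (x * y + x * d′ + d * y + d * d′) * c
      expand = solve-∀
      collect : ∀ N φ e c d D r R →
        N * (φ + D * e) + (1ℤ + d) * e + r * e + (1ℤ + 1ℤ * D + R + d * D) * c ≡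
        N * φ + (1ℤ + d) * e + (r + N * D) * e + (1ℤ + D + R + d * D) * c
      collect = solve-∀
      first : ∑[ p < suc M ] (φ₂ + D q * e + (X p q + D p) * e + X q p * e) ≡ N * (φ₂ + D q * e) + (1ℤ + d) * e + row q * e
      first = trans (∑-+ (suc M) _ _) (cong₂ _+_ (trans (∑-+ (suc M) _ _) (cong₂ _+_ (∑-const (suc M) (φ₂ + D q * e))
        (trans (∑-*ʳ (suc M) e (λ p → X p q + D p)) (cong (_* e) (trans (∑-+ (suc M) (λ p → X p q) D) (cong (_+ d) (column q≤M)))))))
        (∑-*ʳ (suc M) e (X q)))
      second : ∑[ p < suc M ] ((X p q * X q p + X p q * D q + D p * X q p + D p * D q) * c) ≡ (1ℤ + 1ℤ * D q + R q + d * D q) * c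
      second = trans (∑-*ʳ (suc M) c (λ p → X p q * X q p + X p q * D q + D p * X q p + D p * D q)) (cong (_* c)
        (trans (∑-+ (suc M) _ _) (cong₂ _+_ (trans (∑-+ (suc M) _ _) (cong₂ _+_ (trans (∑-+ (suc M) _ _) (cong₂ _+_
          (square-column q≤M)
          (trans (∑-*ʳ (suc M) (D q) (λ p → X p q)) (cong (_* D q) (column q≤M)))))
          refl))
          (∑-*ʳ (suc M) (D q) D))))

    -- `F i q` is the contribution of the insertion with data i and q, whose gap is i for i ≤ q and
    -- i - 1 for i > q. Both i = q and i = q + 1 give the gap q, so two copies of `K-diag q` replace
    -- the entry `K q q`. For Φ = 1 the right-hand side is (M+1)(M+2), the number of insertions.
    total : ∀ (F : ℕ → ℕ → ℤ) →
      (∀ {p q} → p < q → q ≤ M → F p q ≡ K p q) →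
      (∀ {p q} → q < p → p ≤ M → F (suc p) q ≡ K p q) →
      (∀ {q} → q ≤ M → F q q ≡ K-diag q) →
      (∀ {q} → q ≤ M → F (suc q) q ≡ K-diag q) →
      ∑[ q < suc M ] (∑[ i < suc (suc M) ] (F i q)) ≡
        (d * (d + 1ℤ) + + M) * φ₀ + + 2 * (d * (+ M - d) + 1ℤ) * φ₁ + ((+ M - d) * (+ M - d + 1ℤ) + + M) * φ₂
    total F below above diag diag′ = begin
      ∑[ q < suc M ] (∑[ i < suc (suc M) ] (F i q))
        ≡⟨ ∑-cong (suc M) (λ {q} q<1+M → let q≤M = ℕ.s≤s⁻¹ q<1+M in
             trans (∑-pinch (suc M) (λ i → F i q) (λ p → K p q) q<1+M (λ p<q → below p<q q≤M) (λ q<p p<1+M → above q<p (ℕ.s≤s⁻¹ p<1+M)))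
               (cong₂ _+_ (K-column q≤M) (excess q≤M))) ⟩
      ∑[ q < suc M ] (S q + (φ₂ - Z q q * c))
        ≡⟨ ∑-cong (suc M) (λ {q} _ → collect N φ₂ e c d (D q) (row q) (R q) (X q q)) ⟩
      ∑[ q < suc M ] ((N * φ₂ + (1ℤ + d) * e + c + φ₂) + row q * e + R q * c + X q q * - c + D q * (N * e + d * c))
        ≡⟨ trans (∑-+ (suc M) _ _) (cong₂ _+_ (trans (∑-+ (suc M) _ _) (cong₂ _+_
            (trans (∑-+ (suc M) _ _) (cong₂ _+_ (trans (∑-+ (suc M) _ _) (cong₂ _+_
             (∑-const (suc M) (N * φ₂ + (1ℤ + d) * e + c + φ₂))
             (trans (∑-*ʳ (suc M) e row) (cong (_* e) ∑row))))
             (trans (∑-*ʳ (suc M) c R) (cong (_* c) ∑R))))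
             (trans (∑-*ʳ (suc M) (- c) (λ q → X q q)) (cong (_* - c) trace))))
             (∑-*ʳ (suc M) (N * e + d * c) D)) ⟩
      N * (N * φ₂ + (1ℤ + d) * e + c + φ₂) + N * e + d * c + 1ℤ * - c + d * (N * e + d * c)
        ≡⟨ final (+ M) d φ₀ φ₁ φ₂ ⟩
      (d * (d + 1ℤ) + + M) * φ₀ + + 2 * (d * (+ M - d) + 1ℤ) * φ₁ + ((+ M - d) * (+ M - d + 1ℤ) + + M) * φ₂ ∎
      where
      open ≡-Reasoning
      excess : ∀ {q} → q ≤ M → F q q + F (suc q) q - K q q ≡ φ₂ - Z q q * c
      excess {q} q≤M = begin
        F q q + F (suc q) q - K q q
          ≡⟨ cong₂ _-_ (cong₂ _+_ (trans (diag q≤M) (linear (Z-binary q q))) (trans (diag′ q≤M) (linear (Z-binary q q))))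
              (trans (bilinear (Z-binary q q) (Z-binary q q)) (cong (λ z → φ₂ + Z q q * e + Z q q * e + z * c) (Z-idem q q))) ⟩
        φ₂ + Z q q * e + (φ₂ + Z q q * e) - (φ₂ + Z q q * e + Z q q * e + Z q q * c)
          ≡⟨ cancel φ₂ (Z q q) e c ⟩
        φ₂ - Z q q * c ∎
        where
        cancel : ∀ φ z e c → φ + z * e + (φ + z * e) - (φ + z * e + z * e + z * c) ≡ φ - z * c
        cancel = solve-∀
      collect : ∀ N φ e c d D r R x →
        N * φ + (1ℤ + d) * e + (r + N * D) * e + (1ℤ + D + R + d * D) * c + (φ - (x + D) * c) ≡
        (N * φ + (1ℤ + d) * e + c + φ) + r * e + R * c + x * - c + D * (N * e + d * c)
      collect = solve-∀
      final : ∀ M d φ₀ φ₁ φ₂ → let N = 1ℤ + M ; e = φ₁ - φ₂ ; c = φ₀ - + 2 * φ₁ + φ₂ in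
        N * (N * φ₂ + (1ℤ + d) * e + c + φ₂) + N * e + d * c + 1ℤ * - c + d * (N * e + d * c) ≡
        (d * (d + 1ℤ) + M) * φ₀ + + 2 * (d * (M - d) + 1ℤ) * φ₁ + ((M - d) * (M - d + 1ℤ) + M) * φ₂
      final = solve-∀

-- Descents of an insertion

-- The word v with letters shifted to 1,…,k, preceded by x and followed by k+1 forever.
extend : ∀ {k l} → ℕ → Vec (Fin k) l → ℕ → ℕ
extend     x v        zero    = x
extend {k} x []       (suc p) = suc k
extend     x (y ∷ ys) (suc p) = extend (suc (toℕ y)) ys p

-- The start value makes insertions accessible to induction, and 0 serves as the left sentinel. The
-- right sentinel exceeds all letters and never causes a drop.
drops : ∀ {k l} → ℕ → Vec (Fin k) l → ℤ
drops x []       = 0ℤ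
drops x (y ∷ ys) = ⟦ suc (toℕ y) ℕ.<? x ⟧ + drops (suc (toℕ y)) ys

drops-des : ∀ {k l} (v : Vec (Fin k) l) → drops 0 v ≡ + des v
drops-des []       = refl
drops-des (x ∷ xs) = trans (ℤ.+-identityˡ _) (from x xs)
  where
  from : ∀ {k l} (x : Fin k) (xs : Vec (Fin k) l) → drops (suc (toℕ x)) xs ≡ + des (x ∷ xs)
  from x []       = refl
  from x (y ∷ ys) rewrite from y ys with does (y Fin.<? x)
  ... | true  = refl
  ... | false = refl

module _ {k : ℕ} where

  extend-lookup : ∀ {l} x (v : Vec (Fin k) l) i → extend x v (suc (toℕ i)) ≡ suc (toℕ (lookup v i))
  extend-lookup x (y ∷ ys) Fin.zero    = refl
  extend-lookup x (y ∷ ys) (Fin.suc i) = extend-lookup (suc (toℕ y)) ys i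

  extend-top : ∀ {l} x (v : Vec (Fin k) l) → extend x v (suc l) ≡ suc k
  extend-top x []       = refl
  extend-top x (y ∷ ys) = extend-top (suc (toℕ y)) ys

  -- The sum has one more term than the word has comparisons; it compares the last entry with the
  -- sentinel k + 1 and vanishes.
  drops-∑ : ∀ {l x} (v : Vec (Fin k) l) → x ≤ suc k →
    drops x v ≡ ∑[ p < suc l ] ⟦ extend x v (suc p) ℕ.<? extend x v p ⟧
  drops-∑ {x = x} [] x≤1+k = sym (trans (ℤ.+-identityˡ _) (⟦⟧-false (suc k ℕ.<? x) (ℕ.≤⇒≯ x≤1+k)))
  drops-∑ {suc l} {x} (y ∷ ys) x≤1+k = trans
    (cong (λ s → ⟦ suc (toℕ y) ℕ.<? x ⟧ + s) (drops-∑ ys (ℕ.m≤n⇒m≤1+n (Fin.toℕ<n y))))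
    (sym (∑-front (suc l) (λ p → ⟦ extend x (y ∷ ys) (suc p) ℕ.<? extend x (y ∷ ys) p ⟧)))

  -- The new letter replaces one comparison, of its right neighbour with its left one, by two. At
  -- the end of the word the right neighbour is the sentinel.
  drops-insertAt : ∀ {l x} (v : Vec (Fin k) l) q z → x ≤ suc k →
    let left = extend x v (toℕ q) ; right = extend x v (suc (toℕ q)) in
    drops x (insertAt v q z) ≡
      drops x v + (⟦ suc (toℕ z) ℕ.<? left ⟧ + ⟦ right ℕ.<? suc (toℕ z) ⟧ - ⟦ right ℕ.<? left ⟧)
  drops-insertAt {x = x} [] Fin.zero z x≤1+k = sym (begin
    0ℤ + (⟦ suc (toℕ z) ℕ.<? x ⟧ + ⟦ suc k ℕ.<? suc (toℕ z) ⟧ - ⟦ suc k ℕ.<? x ⟧)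
      ≡⟨ cong₂ (λ s t → 0ℤ + (⟦ suc (toℕ z) ℕ.<? x ⟧ + s - t)) (⟦⟧-false (suc k ℕ.<? suc (toℕ z)) (ℕ.<⇒≯ (s≤s (Fin.toℕ<n z))))
          (⟦⟧-false (suc k ℕ.<? x) (ℕ.≤⇒≯ x≤1+k)) ⟩
    0ℤ + (⟦ suc (toℕ z) ℕ.<? x ⟧ + 0ℤ - 0ℤ)
      ≡⟨ lem ⟦ suc (toℕ z) ℕ.<? x ⟧ ⟩
    ⟦ suc (toℕ z) ℕ.<? x ⟧ + 0ℤ ∎)
    where
    open ≡-Reasoning
    lem : ∀ u → 0ℤ + (u + 0ℤ - 0ℤ) ≡ u + 0ℤ
    lem = solve-∀
  drops-insertAt {x = x} (y ∷ ys) Fin.zero z x≤1+k =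
    lem ⟦ suc (toℕ z) ℕ.<? x ⟧ ⟦ suc (toℕ y) ℕ.<? suc (toℕ z) ⟧ ⟦ suc (toℕ y) ℕ.<? x ⟧ (drops (suc (toℕ y)) ys)
    where
    lem : ∀ u v w d → u + (v + d) ≡ w + d + (u + v - w)
    lem = solve-∀
  drops-insertAt {x = x} (y ∷ ys) (Fin.suc q) z x≤1+k = trans
    (cong (λ s → ⟦ suc (toℕ y) ℕ.<? x ⟧ + s) (drops-insertAt ys q z (ℕ.m≤n⇒m≤1+n (Fin.toℕ<n y))))
    (sym (ℤ.+-assoc ⟦ suc (toℕ y) ℕ.<? x ⟧ (drops (suc (toℕ y)) ys) _))

  extend-insertAt-≤ : ∀ {l} x (v : Vec (Fin k) l) q z {p} → p ≤ toℕ q →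
    extend x (insertAt v q z) p ≡ extend x v p
  extend-insertAt-≤ x v        q           z {zero}  _         = refl
  extend-insertAt-≤ x (y ∷ ys) (Fin.suc q) z {suc p} (s≤s p≤q) = extend-insertAt-≤ (suc (toℕ y)) ys q z p≤q

  extend-insertAt-≡ : ∀ {l} x (v : Vec (Fin k) l) q z →
    extend x (insertAt v q z) (suc (toℕ q)) ≡ suc (toℕ z)
  extend-insertAt-≡ x v        Fin.zero    z = refl
  extend-insertAt-≡ x (y ∷ ys) (Fin.suc q) z = extend-insertAt-≡ (suc (toℕ y)) ys q z

  extend-insertAt-> : ∀ {l} x (v : Vec (Fin k) l) q z {p} → toℕ q < p →
    extend x (insertAt v q z) (suc p) ≡ extend x v p
  extend-insertAt-> x []       Fin.zero    z {suc p} _         = refl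
  extend-insertAt-> x (y ∷ ys) Fin.zero    z {suc p} _         = refl
  extend-insertAt-> x (y ∷ ys) (Fin.suc q) z {suc p} (s≤s q<p) = extend-insertAt-> (suc (toℕ y)) ys q z q<p

punchIn-< : ∀ {n} (j : Fin (suc n)) (x : Fin n) → toℕ x < toℕ j → toℕ (punchIn j x) ≡ toℕ x
punchIn-< (Fin.suc j) Fin.zero    _         = refl
punchIn-< (Fin.suc j) (Fin.suc x) (s≤s x<j) = cong suc (punchIn-< j x x<j)

punchIn-≥ : ∀ {n} (j : Fin (suc n)) (x : Fin n) → toℕ j ≤ toℕ x → toℕ (punchIn j x) ≡ suc (toℕ x)
punchIn-≥ Fin.zero    x           _         = refl
punchIn-≥ (Fin.suc j) (Fin.suc x) (s≤s j≤x) = cong suc (punchIn-≥ j x j≤x)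

punchIn-mono-< : ∀ {n} (j : Fin (suc n)) (x y : Fin n) → toℕ x < toℕ y → toℕ (punchIn j x) < toℕ (punchIn j y)
punchIn-mono-< j x y x<y = ℕ.≰⇒> (λ le → ℕ.<⇒≱ x<y (Fin.punchIn-cancel-≤ j y x le))

-- An order embedding g, extended to the two sentinel values.
data Matched {k k′} (g : Fin k → Fin k′) : ℕ → ℕ → Set where
  bottom : Matched g 0 0
  inner  : ∀ x → Matched g (suc (toℕ x)) (suc (toℕ (g x)))
  top    : Matched g (suc k) (suc k′)

extend-map : ∀ {k k′ l x y} (g : Fin k → Fin k′) (v : Vec (Fin k) l) p → Matched g x y →
  Matched g (extend x v p) (extend y (map g v) p)
extend-map g v        zero    m = m
extend-map g []       (suc p) m = top
extend-map g (y ∷ ys) (suc p) m = extend-map g ys p (inner y)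

module _ {k k′} {g : Fin k → Fin k′} (g-mono : ∀ x y → toℕ x < toℕ y → toℕ (g x) < toℕ (g y)) where

  g-cancel : ∀ x y → toℕ (g x) < toℕ (g y) → toℕ x < toℕ y
  g-cancel x y gx<gy with ℕ.<-cmp (toℕ x) (toℕ y)
  ... | tri< x<y _ _ = x<y
  ... | tri≈ _ x≡y _ = contradiction gx<gy (ℕ.<-irrefl (cong (toℕ ∘ g) (Fin.toℕ-injective x≡y)))
  ... | tri> _ _ y<x = contradiction gx<gy (ℕ.<⇒≯ (g-mono y x y<x))

  matched-<? : ∀ {x y x′ y′} → Matched g x x′ → Matched g y y′ → ⟦ x′ ℕ.<? y′ ⟧ ≡ ⟦ x ℕ.<? y ⟧
  matched-<? {x} {y} {x′} {y′} m n = ⟦⟧-cong (x′ ℕ.<? y′) (x ℕ.<? y) (to m n) (from m n)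
    where
    to : ∀ {x y x′ y′} → Matched g x x′ → Matched g y y′ → x′ < y′ → x < y
    to bottom    (inner y) _           = s≤s z≤n
    to bottom    top       _           = s≤s z≤n
    to (inner x) (inner y) (s≤s gx<gy) = s≤s (g-cancel x y gx<gy)
    to (inner x) top       _           = s≤s (Fin.toℕ<n x)
    to top       (inner y) (s≤s k<gy)  = contradiction k<gy (ℕ.<⇒≯ (Fin.toℕ<n (g y)))
    to top       top       k<k         = contradiction k<k (ℕ.<-irrefl refl)
    from : ∀ {x y x′ y′} → Matched g x x′ → Matched g y y′ → x < y → x′ < y′
    from bottom    (inner y) _         = s≤s z≤n
    from bottom    top       _         = s≤s z≤n
    from (inner x) (inner y) (s≤s x<y) = s≤s (g-mono x y x<y)
    from (inner x) top       _         = s≤s (Fin.toℕ<n (g x))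
    from top       (inner y) (s≤s k<y) = contradiction k<y (ℕ.<⇒≯ (Fin.toℕ<n y))
    from top       top       k<k       = contradiction k<k (ℕ.<-irrefl refl)

  drops-map : ∀ {l x y} (v : Vec (Fin k) l) → Matched g x y → drops y (map g v) ≡ drops x v
  drops-map []       m = refl
  drops-map (y ∷ ys) m = cong₂ _+_ (matched-<? (inner y) m) (drops-map ys (inner y))

module _ {k k′} {g : Fin k → Fin k′} (z : Fin k′) {P : ℕ} (P≤k : P ≤ k)
  (below : ∀ x → toℕ x < P → toℕ (g x) < toℕ z) (above : ∀ x → P ≤ toℕ x → toℕ z < toℕ (g x)) where

  -- The new letter z lies above the images of the first P letters and below all others. As letters
  -- are shifted by one, x ≤ P says precisely that x is the left sentinel or one of these P letters,
  -- so comparisons with z become entries of the matrix H.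
  matched-<z : ∀ {x x′} → Matched g x x′ → ⟦ x′ ℕ.<? suc (toℕ z) ⟧ ≡ ⟦ x ℕ.≤? P ⟧
  matched-<z {x} {x′} m = ⟦⟧-cong (x′ ℕ.<? suc (toℕ z)) (x ℕ.≤? P) (to m) (from m)
    where
    to : ∀ {x x′} → Matched g x x′ → x′ < suc (toℕ z) → x ≤ P
    to bottom    _          = z≤n
    to (inner x) (s≤s gx<z) = ℕ.≰⇒> (λ P≤x → ℕ.<⇒≯ gx<z (above x P≤x))
    to top       (s≤s k<z)  = contradiction k<z (ℕ.<⇒≯ (Fin.toℕ<n z))
    from : ∀ {x x′} → Matched g x x′ → x ≤ P → x′ < suc (toℕ z)
    from bottom    _   = s≤s z≤n
    from (inner x) x<P = s≤s (below x x<P)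
    from top       k<P = contradiction k<P (ℕ.≤⇒≯ P≤k)

  matched-z< : ∀ {x x′} → Matched g x x′ → ⟦ suc (toℕ z) ℕ.<? x′ ⟧ ≡ 1ℤ - ⟦ x ℕ.≤? P ⟧
  matched-z< {x} {x′} m = ⟦⟧-complement (suc (toℕ z) ℕ.<? x′) (x ℕ.≤? P) (to m) (from m)
    where
    to : ∀ {x x′} → Matched g x x′ → x ≤ P → ¬ (suc (toℕ z) < x′)
    to bottom    _   ()
    to (inner x) x<P (s≤s z<gx) = ℕ.<⇒≯ z<gx (below x x<P)
    to top       k<P _          = ℕ.≤⇒≯ P≤k k<P
    from : ∀ {x x′} → Matched g x x′ → ¬ (x ≤ P) → suc (toℕ z) < x′
    from bottom    x≰P = contradiction z≤n x≰P
    from (inner x) x≮P = s≤s (above x (ℕ.≮⇒≥ x≮P))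
    from top       _   = s≤s (Fin.toℕ<n z)

-- The letters of v are relabelled to make room for the cycle (i , punchIn i j).
insertCycle : ∀ {M} → Fin (suc (suc M)) → Fin (suc M) → Vec (Fin M) M → Vec (Fin (suc (suc M))) (suc (suc M))
insertCycle i j v = insertAt (insertAt (map (punchIn i ∘ punchIn j) v) j i) i (punchIn i j)

-- The gap of v into which the letter i of insertCycle i j v is inserted.
gap : ℕ → ℕ → ℕ
gap j i with i ℕ.≤? j
... | yes _ = i
... | no  _ = ℕ.pred i

gap-≤ : ∀ {j i} → i ≤ j → gap j i ≡ i
gap-≤ {j} {i} i≤j with i ℕ.≤? j
... | yes _   = refl
... | no  i≰j = contradiction i≤j i≰j

gap-> : ∀ {j i} → j < i → gap j i ≡ ℕ.pred i
gap-> {j} {i} j<i with i ℕ.≤? j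
... | yes i≤j = contradiction i≤j (ℕ.<⇒≱ j<i)
... | no  _   = refl

module DesInsert {M} (v : Vec (Fin M) M) (i : Fin (suc (suc M))) (j : Fin (suc M)) where

  -- `h`, `D` and `z` coincide by definition with `H`, `D` and `Z` of `GapCount` for a =
  -- `extend 0 v`; the two modules are joined through this in `des-F`.
  h : ℕ → ℕ → ℤ
  h p q = ⟦ extend 0 v p ℕ.≤? q ⟧

  D : ℕ → ℤ
  D p = ⟦ extend 0 v (suc p) ℕ.<? extend 0 v p ⟧

  z : ℕ → ℕ → ℤ
  z p q = h p q - h (suc p) q + D p

  g : Fin M → Fin (suc (suc M))
  g = punchIn i ∘ punchIn j

  P Q : ℕ
  P = gap (toℕ j) (toℕ i)
  Q = toℕ j

  Q≤M : Q ≤ M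
  Q≤M = ℕ.s≤s⁻¹ (Fin.toℕ<n j)

  g-mono : ∀ x y → toℕ x < toℕ y → toℕ (g x) < toℕ (g y)
  g-mono x y x<y = punchIn-mono-< i (punchIn j x) (punchIn j y) (punchIn-mono-< j x y x<y)

  punch-below : ∀ {n} (i : Fin (suc n)) (x : Fin n) → toℕ x < toℕ i → toℕ (punchIn i x) < toℕ i
  punch-below i x x<i = subst (_< toℕ i) (sym (punchIn-< i x x<i)) x<i

  punch-above : ∀ {n} (i : Fin (suc n)) (x : Fin n) → toℕ i ≤ toℕ x → toℕ i < toℕ (punchIn i x)
  punch-above i x i≤x = subst (toℕ i <_) (sym (punchIn-≥ i x i≤x)) (s≤s i≤x)

  j-below : ∀ x → toℕ x < Q → toℕ (g x) < toℕ (punchIn i j)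
  j-below x x<Q = punchIn-mono-< i (punchIn j x) j (punch-below j x x<Q)

  j-above : ∀ x → Q ≤ toℕ x → toℕ (punchIn i j) < toℕ (g x)
  j-above x Q≤x = punchIn-mono-< i j (punchIn j x) (punch-above j x Q≤x)

  i-below : ∀ x → toℕ x < P → toℕ (g x) < toℕ i
  i-below x x<P = punch-below i (punchIn j x) lem
    where
    lem : toℕ (punchIn j x) < toℕ i
    lem with toℕ i ℕ.≤? Q
    ... | yes i≤Q = subst (_< toℕ i) (sym (punchIn-< j x (ℕ.<-≤-trans x<P i≤Q))) x<P
    ... | no  i≰Q with toℕ x ℕ.<? Q
    ...   | yes x<Q = ℕ.<-trans (punch-below j x x<Q) (ℕ.≰⇒> i≰Q)
    ...   | no  x≮Q = subst (_< toℕ i) (sym (punchIn-≥ j x (ℕ.≮⇒≥ x≮Q))) (suc-<-pred x<P)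
      where
      suc-<-pred : ∀ {m n} → m < ℕ.pred n → suc m < n
      suc-<-pred {n = suc n} m<n = s≤s m<n

  i-above : ∀ x → P ≤ toℕ x → toℕ i < toℕ (g x)
  i-above x P≤x = punch-above i (punchIn j x) lem
    where
    lem : toℕ i ≤ toℕ (punchIn j x)
    lem with toℕ i ℕ.≤? Q
    ... | no  i≰Q = subst (toℕ i ≤_) (sym (punchIn-≥ j x (ℕ.≤-trans (ℕ.<⇒≤pred (ℕ.≰⇒> i≰Q)) P≤x))) (pred-≤-suc P≤x)
      where
      pred-≤-suc : ∀ {m n} → ℕ.pred n ≤ m → n ≤ suc m
      pred-≤-suc {n = zero}  _   = z≤n
      pred-≤-suc {n = suc n} n≤m = s≤s n≤m
    ... | yes i≤Q with toℕ x ℕ.<? Q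
    ...   | yes x<Q = subst (toℕ i ≤_) (sym (punchIn-< j x x<Q)) P≤x
    ...   | no  x≮Q = subst (toℕ i ≤_) (sym (punchIn-≥ j x (ℕ.≮⇒≥ x≮Q))) (ℕ.m≤n⇒m≤1+n P≤x)

  P≤M : P ≤ M
  P≤M with toℕ i ℕ.≤? Q
  ... | yes i≤Q = ℕ.≤-trans i≤Q Q≤M
  ... | no  _   = ℕ.pred-mono-≤ (ℕ.s≤s⁻¹ (Fin.toℕ<n i))

  letters : ℕ → ℕ
  letters = extend 0 (map g v)

  matched : ∀ p → Matched g (extend 0 v p) (letters p)
  matched p = extend-map g v p bottom

  -- The letter i is the image of its partner, so it goes into the partner's gap Q while its value
  -- sits at level P. Hence the position of the first insertion is Q and the threshold is P.
  des-insert-i : drops 0 (insertAt (map g v) j i) ≡ + des v + (1ℤ - z Q P)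
  des-insert-i = begin
    drops 0 (insertAt (map g v) j i)
      ≡⟨ drops-insertAt (map g v) j i z≤n ⟩
    drops 0 (map g v) + (⟦ suc (toℕ i) ℕ.<? letters Q ⟧ + ⟦ letters (suc Q) ℕ.<? suc (toℕ i) ⟧ - ⟦ letters (suc Q) ℕ.<? letters Q ⟧)
      ≡⟨ cong₂ _+_ (trans (drops-map g-mono v bottom) (drops-des v)) (cong₂ _-_ (cong₂ _+_
           (matched-z< i P≤M i-below i-above (matched Q)) (matched-<z i P≤M i-below i-above (matched (suc Q))))
           (matched-<? g-mono (matched (suc Q)) (matched Q))) ⟩
    + des v + (1ℤ - h Q P + h (suc Q) P - D Q)
      ≡⟨ lem (+ des v) (h Q P) (h (suc Q) P) (D Q) ⟩
    + des v + (1ℤ - z Q P) ∎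
    where
    open ≡-Reasoning
    lem : ∀ d u v w → d + (1ℤ - u + v - w) ≡ d + (1ℤ - (u - v + w))
    lem = solve-∀

  change : ℕ → ℕ → ℤ
  change l r = ⟦ suc (toℕ (punchIn i j)) ℕ.<? l ⟧ + ⟦ r ℕ.<? suc (toℕ (punchIn i j)) ⟧ - ⟦ r ℕ.<? l ⟧

  des-insert-j : ∀ {l r} → extend 0 (insertAt (map g v) j i) (toℕ i) ≡ l →
    extend 0 (insertAt (map g v) j i) (suc (toℕ i)) ≡ r →
    + des (insertCycle i j v) ≡ + des v + (1ℤ - z Q P) + change l r
  des-insert-j {l} {r} refl refl = trans (sym (drops-des (insertCycle i j v)))
    (trans (drops-insertAt (insertAt (map g v) j i) i (punchIn i j) z≤n) (cong (_+ change l r) des-insert-i))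

  change-letters : ∀ p → change (letters p) (letters (suc p)) ≡ 1ℤ - z p Q
  change-letters p = trans (cong₂ _-_ (cong₂ _+_
    (matched-z< (punchIn i j) Q≤M j-below j-above (matched p))
    (matched-<z (punchIn i j) Q≤M j-below j-above (matched (suc p))))
    (matched-<? g-mono (matched (suc p)) (matched p)))
    (lem (h p Q) (h (suc p) Q) (D p))
    where
    lem : ∀ u v w → 1ℤ - u + v - w ≡ 1ℤ - (u - v + w)
    lem = solve-∀

  des-apart′ : ∀ {p} → P ≡ p → + des (insertCycle i j v) ≡ + des v + (1ℤ - z Q P) + change (letters p) (letters (suc p)) →
    + des (insertCycle i j v) ≡ + des v + + 2 - z P Q - z Q P
  des-apart′ {p} refl eq = trans eq (trans (cong (λ c → + des v + (1ℤ - z Q P) + c) (change-letters p)) (lem (+ des v) (z Q P) (z P Q)))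
    where
    lem : ∀ d u v → d + (1ℤ - u) + (1ℤ - v) ≡ d + + 2 - v - u
    lem = solve-∀

  des-same′ : ∀ {l r} → P ≡ Q → + des (insertCycle i j v) ≡ + des v + (1ℤ - z Q P) + change l r → change l r ≡ 1ℤ →
    + des (insertCycle i j v) ≡ + des v + + 2 - z Q Q
  des-same′ P≡Q eq change≡1 = trans eq (trans (cong₂ (λ p c → + des v + (1ℤ - z Q p) + c) P≡Q change≡1) (lem (+ des v) (z Q Q)))
    where
    lem : ∀ d u → d + (1ℤ - u) + 1ℤ ≡ d + + 2 - u
    lem = solve-∀

  des-insertCycle-< : toℕ i < Q → + des (insertCycle i j v) ≡ + des v + + 2 - z P Q - z Q P
  des-insertCycle-< i<Q = des-apart′ (gap-≤ (ℕ.<⇒≤ i<Q))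
    (des-insert-j (extend-insertAt-≤ 0 (map g v) j i (ℕ.<⇒≤ i<Q)) (extend-insertAt-≤ 0 (map g v) j i i<Q))

  des-insertCycle-> : ∀ {p} → toℕ i ≡ suc p → Q < p → + des (insertCycle i j v) ≡ + des v + + 2 - z P Q - z Q P
  des-insertCycle-> {p} i≡1+p Q<p = des-apart′
    (trans (gap-> (subst (Q <_) (sym i≡1+p) (ℕ.m<n⇒m<1+n Q<p))) (cong ℕ.pred i≡1+p))
    (des-insert-j
      (trans (cong (extend 0 (insertAt (map g v) j i)) i≡1+p) (extend-insertAt-> 0 (map g v) j i Q<p))
      (trans (cong (extend 0 (insertAt (map g v) j i) ∘ suc) i≡1+p) (extend-insertAt-> 0 (map g v) j i (ℕ.m<n⇒m<1+n Q<p))))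

  -- The two letters are adjacent both as positions and as values, so they compare alike with every
  -- other letter. The second one therefore adds only the descent inside the pair, which is always
  -- decreasing because neighbours are exchanged. The same holds in `des-insertCycle-≡suc`, where
  -- the mark is on the other letter.
  des-insertCycle-≡ : toℕ i ≡ Q → + des (insertCycle i j v) ≡ + des v + + 2 - z Q Q
  des-insertCycle-≡ i≡Q = des-same′ {letters (toℕ i)} {suc (toℕ i)} P≡Q
    (des-insert-j (extend-insertAt-≤ 0 (map g v) j i (ℕ.≤-reflexive i≡Q))
      (trans (cong (extend 0 (insertAt (map g v) j i) ∘ suc) i≡Q) (extend-insertAt-≡ 0 (map g v) j i)))
    (begin
      change (letters (toℕ i)) (suc (toℕ i))
        ≡⟨ cong₂ _-_ (cong₂ _+_ (matched-z< (punchIn i j) Q≤M j-below j-above (matched (toℕ i)))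
             (⟦⟧-true (suc (toℕ i) ℕ.<? suc (toℕ (punchIn i j))) (s≤s i<j)))
             (matched-z< i P≤M i-below i-above (matched (toℕ i))) ⟩
      1ℤ - h (toℕ i) Q + 1ℤ - (1ℤ - h (toℕ i) P)
        ≡⟨ cong (λ p → 1ℤ - h (toℕ i) Q + 1ℤ - (1ℤ - h (toℕ i) p)) P≡Q ⟩
      1ℤ - h (toℕ i) Q + 1ℤ - (1ℤ - h (toℕ i) Q)
        ≡⟨ lem (h (toℕ i) Q) ⟩
      1ℤ ∎)
    where
    open ≡-Reasoning
    P≡Q : P ≡ Q
    P≡Q = trans (gap-≤ (ℕ.≤-reflexive i≡Q)) i≡Q
    i<j : toℕ i < toℕ (punchIn i j)
    i<j = punch-above i j (ℕ.≤-reflexive i≡Q)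
    lem : ∀ u → 1ℤ - u + 1ℤ - (1ℤ - u) ≡ 1ℤ
    lem = solve-∀

  des-insertCycle-≡suc : toℕ i ≡ suc Q → + des (insertCycle i j v) ≡ + des v + + 2 - z Q Q
  des-insertCycle-≡suc i≡1+Q = des-same′ {suc (toℕ i)} {letters (suc Q)} P≡Q
    (des-insert-j (trans (cong (extend 0 (insertAt (map g v) j i)) i≡1+Q) (extend-insertAt-≡ 0 (map g v) j i))
      (trans (cong (extend 0 (insertAt (map g v) j i) ∘ suc) i≡1+Q) (extend-insertAt-> 0 (map g v) j i ℕ.≤-refl)))
    (begin
      change (suc (toℕ i)) (letters (suc Q))
        ≡⟨ cong₂ _-_ (cong₂ _+_ (⟦⟧-true (suc (toℕ (punchIn i j)) ℕ.<? suc (toℕ i)) (s≤s j<i))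
             (matched-<z (punchIn i j) Q≤M j-below j-above (matched (suc Q))))
             (matched-<z i P≤M i-below i-above (matched (suc Q))) ⟩
      1ℤ + h (suc Q) Q - h (suc Q) P
        ≡⟨ cong (λ p → 1ℤ + h (suc Q) Q - h (suc Q) p) P≡Q ⟩
      1ℤ + h (suc Q) Q - h (suc Q) Q
        ≡⟨ lem (h (suc Q) Q) ⟩
      1ℤ ∎)
    where
    open ≡-Reasoning
    Q<i : Q < toℕ i
    Q<i = ℕ.≤-reflexive (sym i≡1+Q)
    P≡Q : P ≡ Q
    P≡Q = trans (gap-> Q<i) (cong ℕ.pred i≡1+Q)
    j<i : toℕ (punchIn i j) < toℕ i
    j<i = punch-below i j Q<i
    lem : ∀ u → 1ℤ + u - u ≡ 1ℤ
    lem = solve-∀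

-- The insertion bijection

module _ {A : Set} where

  ∑ₗ : List A → (A → ℤ) → ℤ
  ∑ₗ []       f = 0ℤ
  ∑ₗ (x ∷ xs) f = f x + ∑ₗ xs f

  ∑ₗ-cong : ∀ xs {f g : A → ℤ} → (∀ {x} → x ∈ xs → f x ≡ g x) → ∑ₗ xs f ≡ ∑ₗ xs g
  ∑ₗ-cong []       f≗g = refl
  ∑ₗ-cong (x ∷ xs) f≗g = cong₂ _+_ (f≗g (here refl)) (∑ₗ-cong xs (f≗g ∘ there))

  ∑ₗ-+ : ∀ xs (f g : A → ℤ) → ∑ₗ xs (λ x → f x + g x) ≡ ∑ₗ xs f + ∑ₗ xs g
  ∑ₗ-+ []       f g = refl
  ∑ₗ-+ (x ∷ xs) f g = trans (cong (λ s → f x + g x + s) (∑ₗ-+ xs f g)) (interchange (f x) (g x) (∑ₗ xs f) (∑ₗ xs g))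
    where
    interchange : ∀ a b c d → a + b + (c + d) ≡ a + c + (b + d)
    interchange = solve-∀

  ∑ₗ-*ˡ : ∀ xs c (f : A → ℤ) → ∑ₗ xs (λ x → c * f x) ≡ c * ∑ₗ xs f
  ∑ₗ-*ˡ []       c f = sym (ℤ.*-zeroʳ c)
  ∑ₗ-*ˡ (x ∷ xs) c f = trans (cong (λ s → c * f x + s) (∑ₗ-*ˡ xs c f)) (sym (ℤ.*-distribˡ-+ c (f x) (∑ₗ xs f)))

  ∑ₗ-const : ∀ xs c → ∑ₗ xs (const c) ≡ + length xs * c
  ∑ₗ-const []       c = refl
  ∑ₗ-const (x ∷ xs) c = trans (cong (λ s → c + s) (∑ₗ-const xs c)) (step c (+ length xs))
    where
    step : ∀ c l → c + l * c ≡ (1ℤ + l) * c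
    step = solve-∀

  ∑ₗ-++ : ∀ xs ys (f : A → ℤ) → ∑ₗ (xs ++ ys) f ≡ ∑ₗ xs f + ∑ₗ ys f
  ∑ₗ-++ []       ys f = sym (ℤ.+-identityˡ _)
  ∑ₗ-++ (x ∷ xs) ys f = trans (cong (λ s → f x + s) (∑ₗ-++ xs ys f)) (sym (ℤ.+-assoc (f x) _ _))

  ∑ₗ-↭ : ∀ {xs ys} (f : A → ℤ) → xs ↭ ys → ∑ₗ xs f ≡ ∑ₗ ys f
  ∑ₗ-↭ f ↭.refl          = refl
  ∑ₗ-↭ f (↭.prep x p)    = cong (λ s → f x + s) (∑ₗ-↭ f p)
  ∑ₗ-↭ f (↭.swap x y p)  = trans (cong (λ s → f x + (f y + s)) (∑ₗ-↭ f p)) (exchange (f x) (f y) _)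
    where
    exchange : ∀ a b c → a + (b + c) ≡ b + (a + c)
    exchange = solve-∀
  ∑ₗ-↭ f (↭.trans p q)   = trans (∑ₗ-↭ f p) (∑ₗ-↭ f q)

  length-filter : ∀ {P : A → Set} (P? : ∀ x → Dec (P x)) xs → + length (filter P? xs) ≡ ∑ₗ xs (⟦_⟧ ∘ P?)
  length-filter P? []       = refl
  length-filter P? (x ∷ xs) with P? x
  ... | yes _ = cong (λ s → 1ℤ + s) (length-filter P? xs)
  ... | no  _ = trans (length-filter P? xs) (sym (ℤ.+-identityˡ _))

  ∑ₗ-filter : ∀ {P Q : A → Set} (P? : ∀ x → Dec (P x)) (Q? : ∀ x → Dec (Q x)) xs →
    ∑ₗ xs (λ x → ⟦ P? x ×-dec Q? x ⟧) ≡ ∑ₗ (filter P? xs) (⟦_⟧ ∘ Q?)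
  ∑ₗ-filter P? Q? []       = refl
  ∑ₗ-filter P? Q? (x ∷ xs) with P? x
  ... | yes p = cong₂ _+_ (⟦⟧-cong (yes p ×-dec Q? x) (Q? x) proj₂ (p ,_)) (∑ₗ-filter P? Q? xs)
  ... | no  _ = trans (ℤ.+-identityˡ _) (∑ₗ-filter P? Q? xs)

∑ₗ-map : ∀ {A B : Set} (g : A → B) xs (f : B → ℤ) → ∑ₗ (List.map g xs) f ≡ ∑ₗ xs (f ∘ g)
∑ₗ-map g []       f = refl
∑ₗ-map g (x ∷ xs) f = cong (λ s → f (g x) + s) (∑ₗ-map g xs f)

∑ₗ-cartesianProduct : ∀ {A B : Set} (xs : List A) (ys : List B) (f : A × B → ℤ) →
  ∑ₗ (cartesianProduct xs ys) f ≡ ∑ₗ xs (λ x → ∑ₗ ys (λ y → f (x , y)))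
∑ₗ-cartesianProduct []       ys f = refl
∑ₗ-cartesianProduct (x ∷ xs) ys f = trans (∑ₗ-++ (List.map (x ,_) ys) (cartesianProduct xs ys) f)
  (cong₂ _+_ (∑ₗ-map (x ,_) ys f) (∑ₗ-cartesianProduct xs ys f))

∑ₗ-allFin : ∀ n {f : Fin n → ℤ} {F : ℕ → ℤ} → (∀ i → f i ≡ F (toℕ i)) → ∑ₗ (allFin n) f ≡ ∑ n F
∑ₗ-allFin n {f} f≗F = tabulated n id f≗F
  where
  tabulated : ∀ m {F : ℕ → ℤ} (g : Fin m → Fin n) → (∀ i → f (g i) ≡ F (toℕ i)) → ∑ₗ (List.tabulate g) f ≡ ∑ m F
  tabulated zero    g eq = refl
  tabulated (suc m) {F} g eq = trans (cong₂ _+_ (eq Fin.zero) (tabulated m (g ∘ Fin.suc) (eq ∘ Fin.suc))) (sym (∑-front m F))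

words-complete : ∀ {m l} (v : Vec (Fin m) l) → v ∈ words m l
words-complete []       = here refl
words-complete (x ∷ xs) = ∈-cartesianProductWith⁺ _∷_ (∈-allFin x) (words-complete xs)

words-unique : ∀ m l → List.Unique (words m l)
words-unique m zero    = [] ∷ []
words-unique m (suc l) = ListUnique.cartesianProductWith⁺ _∷_ Vec.∷-injective (ListUnique.allFin⁺ m) (words-unique m l)

involutions : ∀ m → List (Vec (Fin m) m)
involutions m = filter isFPFInvolution? (words m m)

∈-involutions⁺ : ∀ {m} {π : Vec (Fin m) m} → IsFPFInvolution π → π ∈ involutions m
∈-involutions⁺ {π = π} fpf = ∈-filter⁺ isFPFInvolution? (words-complete π) fpf

∈-involutions⁻ : ∀ {m} {π : Vec (Fin m) m} → π ∈ involutions m → IsFPFInvolution π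
∈-involutions⁻ {m} π∈ = proj₂ (∈-filter⁻ isFPFInvolution? {xs = words m m} π∈)

involutions-unique : ∀ m → List.Unique (involutions m)
involutions-unique m = ListUnique.filter⁺ isFPFInvolution? (words-unique m m)

-- The integer index allows the shifts z - 1 and z - 2 and the reflection M - z without truncation.
Jℤ : ℕ → ℤ → ℤ
Jℤ m z = ∑ₗ (involutions m) (λ π → ⟦ + des π ℤ.≟ z ⟧)

J≡Jℤ : ∀ m j → + J m j ≡ Jℤ m (+ j)
J≡Jℤ m j = begin
  + J m j
    ≡⟨ length-filter (λ π → isFPFInvolution? π ×-dec (des π ℕ.≟ j)) (words m m) ⟩
  ∑ₗ (words m m) (λ π → ⟦ isFPFInvolution? π ×-dec (des π ℕ.≟ j) ⟧)
    ≡⟨ ∑ₗ-filter isFPFInvolution? (λ π → des π ℕ.≟ j) (words m m) ⟩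
  ∑ₗ (involutions m) (λ π → ⟦ des π ℕ.≟ j ⟧)
    ≡⟨ ∑ₗ-cong (involutions m) (λ {π} _ → ⟦⟧-cong (des π ℕ.≟ j) (+ des π ℤ.≟ + j) (cong (λ n → + n)) ℤ.+-injective) ⟩
  Jℤ m (+ j) ∎
  where open ≡-Reasoning

Jℤ-negative : ∀ m n → Jℤ m -[1+ n ] ≡ 0ℤ
Jℤ-negative m n = trans (∑ₗ-cong (involutions m) (λ _ → refl)) (trans (∑ₗ-const (involutions m) 0ℤ) (ℤ.*-zeroʳ (+ length (involutions m))))

involutive⇒unique : ∀ {m} {π : Vec (Fin m) m} → (∀ i → lookup π (lookup π i) ≡ i) → Vec.Unique π
involutive⇒unique {π = π} inv = subst Vec.Unique (Vec.tabulate∘lookup π)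
  (VecUnique.tabulate⁺ (λ {i} {j} eq → trans (sym (inv i)) (trans (cong (lookup π) eq) (inv j))))

lookup-extensional : ∀ {A : Set} {n} {u v : Vec A n} → (∀ i → lookup u i ≡ lookup v i) → u ≡ v
lookup-extensional {u = u} {v} eq = trans (sym (Vec.tabulate∘lookup u)) (trans (Vec.tabulate-cong eq) (Vec.tabulate∘lookup v))

module _ {M : ℕ} (i : Fin (suc (suc M))) (j : Fin (suc M)) where

  punch₂ : Fin M → Fin (suc (suc M))
  punch₂ = punchIn i ∘ punchIn j

  punch₂-injective : ∀ {x y} → punch₂ x ≡ punch₂ y → x ≡ y
  punch₂-injective {x} {y} eq = Fin.punchIn-injective j x y (Fin.punchIn-injective i _ _ eq)

  -- Matching on this view replaces the letter by `i`, its partner or some `punch₂ x`, so that the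
  -- three lookup rules apply directly.
  data Position : Fin (suc (suc M)) → Set where
    first  : Position i
    second : Position (punchIn i j)
    other  : ∀ x → Position (punch₂ x)

  position : ∀ y → Position y
  position y with i Fin.≟ y
  ... | yes refl = first
  ... | no  i≢y with j Fin.≟ punchOut i≢y
  ...   | yes j≡y = subst Position (trans (cong (punchIn i) j≡y) (Fin.punchIn-punchOut i≢y)) second
  ...   | no  j≢y = subst Position (trans (cong (punchIn i) (Fin.punchIn-punchOut j≢y)) (Fin.punchIn-punchOut i≢y)) (other (punchOut j≢y))

  module _ (v : Vec (Fin M) M) where

    lookup-first : lookup (insertCycle i j v) i ≡ punchIn i j
    lookup-first = Vec.insertAt-lookup (insertAt (map punch₂ v) j i) i (punchIn i j)

    lookup-second : lookup (insertCycle i j v) (punchIn i j) ≡ i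
    lookup-second = trans (Vec.insertAt-punchIn (insertAt (map punch₂ v) j i) i (punchIn i j) j) (Vec.insertAt-lookup (map punch₂ v) j i)

    lookup-other : ∀ x → lookup (insertCycle i j v) (punch₂ x) ≡ punch₂ (lookup v x)
    lookup-other x = trans (Vec.insertAt-punchIn (insertAt (map punch₂ v) j i) i (punchIn i j) (punchIn j x))
      (trans (Vec.insertAt-punchIn (map punch₂ v) j i x) (Vec.lookup-map x punch₂ v))

    insertCycle-fpf : IsFPFInvolution v → IsFPFInvolution (insertCycle i j v)
    insertCycle-fpf (_ , v-inv , v-fpf) = involutive⇒unique inv , inv , fpf
      where
      π : Vec (Fin (suc (suc M))) (suc (suc M))
      π = insertCycle i j v
      inv : ∀ y → lookup π (lookup π y) ≡ y
      inv y with position y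
      ... | first   = trans (cong (lookup π) lookup-first) lookup-second
      ... | second  = trans (cong (lookup π) lookup-second) lookup-first
      ... | other x = trans (cong (lookup π) (lookup-other x)) (trans (lookup-other (lookup v x)) (cong punch₂ (v-inv x)))
      fpf : ∀ y → lookup π y ≢ y
      fpf y with position y
      ... | first   = λ eq → Fin.punchInᵢ≢i i j (trans (sym lookup-first) eq)
      ... | second  = λ eq → Fin.punchInᵢ≢i i j (sym (trans (sym lookup-second) eq))
      ... | other x = λ eq → v-fpf x (punch₂-injective (trans (sym (lookup-other x)) eq))

insertMarked : ∀ {M} → Vec (Fin M) M × (Fin (suc M) × Fin (suc (suc M))) → Vec (Fin (suc (suc M))) (suc (suc M)) × Fin (suc (suc M))
insertMarked (v , j , i) = insertCycle i j v , i

-- The mark returns i, the image of i returns j, and the values at the remaining positions return v.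
-- Without the mark, the two letters of the cycle could not be told apart.
insertMarked-injective : ∀ {M} {x y : Vec (Fin M) M × (Fin (suc M) × Fin (suc (suc M)))} → insertMarked x ≡ insertMarked y → x ≡ y
insertMarked-injective {x = v , j , i} {v′ , j′ , i′} eq with ,-injective eq
... | π≡π′ , refl with Fin.punchIn-injective i j j′ (trans (sym (lookup-first i j v)) (trans (cong (λ π → lookup π i) π≡π′) (lookup-first i j′ v′)))
...   | refl = cong (_, j , i) (lookup-extensional (λ x → punch₂-injective i j
  (trans (sym (lookup-other i j v x)) (trans (cong (λ π → lookup π (punch₂ i j x)) π≡π′) (lookup-other i j v′ x)))))

module _ {M} (π : Vec (Fin (suc (suc M))) (suc (suc M))) (π-fpf : IsFPFInvolution π) (i : Fin (suc (suc M))) where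

  private
    inv : ∀ i → lookup π (lookup π i) ≡ i
    inv = proj₁ (proj₂ π-fpf)
    fpf : ∀ i → lookup π i ≢ i
    fpf = proj₂ (proj₂ π-fpf)

    j : Fin (suc M)
    j = punchOut (fpf i ∘ sym)

    πi : lookup π i ≡ punchIn i j
    πi = sym (Fin.punchIn-punchOut (fpf i ∘ sym))

    π-injective : ∀ {x y} → lookup π x ≡ lookup π y → x ≡ y
    π-injective {x} {y} eq = trans (sym (inv x)) (trans (cong (lookup π) eq) (inv y))

    -- An involution that exchanges i and its partner maps the complement of this cycle into itself:
    -- a value on the cycle would, by injectivity, put `punch₂ i j x` on the cycle too.
    restricted : ∀ x → ∃ λ y → punch₂ i j y ≡ lookup π (punch₂ i j x)
    restricted x = cases (position i j (lookup π (punch₂ i j x))) refl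
      where
      cases : ∀ {z} → Position i j z → z ≡ lookup π (punch₂ i j x) → ∃ λ y → punch₂ i j y ≡ lookup π (punch₂ i j x)
      cases first eq = contradiction (Fin.punchIn-injective i _ _ (π-injective
          (trans (sym eq) (trans (sym (inv i)) (cong (lookup π) πi))))) (Fin.punchInᵢ≢i j x)
      cases second eq = contradiction (sym (π-injective (trans πi eq))) (Fin.punchInᵢ≢i i (punchIn j x))
      cases (other y) eq = y , eq

    v : Vec (Fin M) M
    v = Vec.tabulate (proj₁ ∘ restricted)

    lookup-v : ∀ x → punch₂ i j (lookup v x) ≡ lookup π (punch₂ i j x)
    lookup-v x = trans (cong (punch₂ i j) (Vec.lookup∘tabulate (proj₁ ∘ restricted) x)) (proj₂ (restricted x))

    v-inv : ∀ x → lookup v (lookup v x) ≡ x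
    v-inv x = punch₂-injective i j (trans (lookup-v (lookup v x)) (trans (cong (lookup π) (lookup-v x)) (inv (punch₂ i j x))))

    v-fpf : ∀ x → lookup v x ≢ x
    v-fpf x eq = fpf (punch₂ i j x) (trans (sym (lookup-v x)) (cong (punch₂ i j) eq))

    π≡ : ∀ y → lookup π y ≡ lookup (insertCycle i j v) y
    π≡ y with position i j y
    ... | first   = trans πi (sym (lookup-first i j v))
    ... | second  = trans (trans (cong (lookup π) (sym πi)) (inv i)) (sym (lookup-second i j v))
    ... | other x = trans (sym (lookup-v x)) (sym (lookup-other i j v x))

  insertMarked-surjective : ∃ λ x → proj₁ x ∈ involutions M × (π , i) ≡ insertMarked x
  insertMarked-surjective = (v , j , i) , ∈-involutions⁺ (involutive⇒unique v-inv , v-inv , v-fpf) , cong (_, i) (lookup-extensional π≡)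

marked : ∀ m → List (Vec (Fin m) m × Fin m)
marked m = cartesianProduct (involutions m) (allFin m)

insertions : ∀ M → List (Vec (Fin M) M × (Fin (suc M) × Fin (suc (suc M))))
insertions M = cartesianProduct (involutions M) (cartesianProduct (allFin (suc M)) (allFin (suc (suc M))))

-- Both lists are free of repetitions, so having the same members already makes them permutations of
-- each other.
marked↭insertions : ∀ M → marked (suc (suc M)) ↭ List.map insertMarked (insertions M)
marked↭insertions M = ∼bag⇒↭ (unique∧set⇒bag
  (ListUnique.cartesianProduct⁺ (involutions-unique (suc (suc M))) (ListUnique.allFin⁺ (suc (suc M))))
  (ListUnique.map⁺ insertMarked-injective (ListUnique.cartesianProduct⁺ (involutions-unique M)
    (ListUnique.cartesianProduct⁺ (ListUnique.allFin⁺ (suc M)) (ListUnique.allFin⁺ (suc (suc M))))))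
  (mk⇔ to from))
  where
  to : ∀ {x} → x ∈ marked (suc (suc M)) → x ∈ List.map insertMarked (insertions M)
  to {π , i} x∈ =
    let (v , j , i′) , v∈ , eq = insertMarked-surjective π (∈-involutions⁻ (proj₁ (∈-cartesianProduct⁻ (involutions (suc (suc M))) (allFin (suc (suc M))) x∈))) i
    in subst (_∈ List.map insertMarked (insertions M)) (sym eq)
         (∈-map⁺ insertMarked (∈-cartesianProduct⁺ v∈ (∈-cartesianProduct⁺ (∈-allFin j) (∈-allFin i′))))
  from : ∀ {x} → x ∈ List.map insertMarked (insertions M) → x ∈ marked (suc (suc M))
  from x∈ with ∈-map⁻ insertMarked x∈
  ... | (v , j , i) , y∈ , refl = ∈-cartesianProduct⁺
    (∈-involutions⁺ (insertCycle-fpf i j v (∈-involutions⁻ (proj₁ (∈-cartesianProduct⁻ (involutions M)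
        (cartesianProduct (allFin (suc M)) (allFin (suc (suc M)))) y∈)))))
    (∈-allFin i)

-- The recurrence for J

module InsertionCount {M} (v : Vec (Fin M) M) (fpf : IsFPFInvolution v) where

  a : ℕ → ℕ
  a = extend 0 v

  data Place : ℕ → Set where
    bottom : Place 0
    inner  : ∀ (i : Fin M) → Place (suc (toℕ i))
    top    : Place (suc M)

  place : ∀ {p} → p ≤ suc M → Place p
  place {zero}  _ = bottom
  place {suc p} (s≤s p≤M) with ℕ.m≤n⇒m<n∨m≡n p≤M
  ... | inj₁ p<M  = subst (Place ∘ suc) (Fin.toℕ-fromℕ< p<M) (inner (fromℕ< p<M))
  ... | inj₂ refl = top

  a-bounded : ∀ {p} → p ≤ suc M → a p ≤ suc M
  a-bounded p≤1+M with place p≤1+M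
  ... | bottom  = z≤n
  ... | inner i = subst (_≤ suc M) (sym (extend-lookup 0 v i)) (ℕ.m≤n⇒m≤1+n (Fin.toℕ<n (lookup v i)))
  ... | top     = ℕ.≤-reflexive (extend-top 0 v)

  a-involutive : ∀ {p} → p ≤ suc M → a (a p) ≡ p
  a-involutive p≤1+M with place p≤1+M
  ... | bottom  = refl
  ... | inner i = trans (cong a (extend-lookup 0 v i)) (trans (extend-lookup 0 v (lookup v i)) (cong (suc ∘ toℕ) (proj₁ (proj₂ fpf) i)))
  ... | top     = trans (cong a (extend-top 0 v)) (extend-top 0 v)

  a-fixpoint-free : ∀ {p} → 0 < p → p ≤ M → a p ≢ p
  a-fixpoint-free {suc p} _ p<M = subst (λ q → a (suc q) ≢ suc q) (Fin.toℕ-fromℕ< p<M)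
    (λ eq → proj₂ (proj₂ fpf) (fromℕ< p<M) (Fin.toℕ-injective (ℕ.suc-injective (trans (sym (extend-lookup 0 v (fromℕ< p<M))) eq))))

  open GapCount M a refl (extend-top 0 v) a-bounded a-involutive a-fixpoint-free

  d≡des : d ≡ + des v
  d≡des = trans (sym (drops-∑ v z≤n)) (drops-des v)

  module _ (Φ : ℤ → ℤ) where

    open Insertions Φ

    -- Written on natural numbers and through `gap`, so that it fits both the list sums over `Fin`
    -- and the four cases of `total`.
    F : ℕ → ℕ → ℤ
    F i q with gap q i ℕ.≟ q
    ... | yes _ = K-diag q
    ... | no  _ = K (gap q i) q

    F-apart : ∀ i q {p} → gap q i ≡ p → p ≢ q → F i q ≡ K p q
    F-apart i q refl p≢q with gap q i ℕ.≟ q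
    ... | yes p≡q = contradiction p≡q p≢q
    ... | no  _   = refl

    F-same : ∀ i q → gap q i ≡ q → F i q ≡ K-diag q
    F-same i q p≡q with gap q i ℕ.≟ q
    ... | yes _   = refl
    ... | no  p≢q = contradiction p≡q p≢q

    ∑-insertCycle : ∑ₗ (allFin (suc M)) (λ j → ∑ₗ (allFin (suc (suc M))) (λ i → Φ (+ des (insertCycle i j v)))) ≡
      (d * (d + 1ℤ) + + M) * φ₀ + + 2 * (d * (+ M - d) + 1ℤ) * φ₁ + ((+ M - d) * (+ M - d + 1ℤ) + + M) * φ₂
    ∑-insertCycle = trans
      (∑ₗ-allFin (suc M) {F = λ q → ∑[ i < suc (suc M) ] (F i q)} (λ j → ∑ₗ-allFin (suc (suc M)) (λ i → des-F i j)))
      (total F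
        (λ {p} {q} p<q q≤M → F-apart p q (gap-≤ (ℕ.<⇒≤ p<q)) (ℕ.<⇒≢ p<q))
        (λ {p} {q} q<p p≤M → F-apart (suc p) q (gap-> (ℕ.m<n⇒m<1+n q<p)) (≢-sym (ℕ.<⇒≢ q<p)))
        (λ {q} _ → F-same q q (gap-≤ ℕ.≤-refl))
        (λ {q} _ → F-same (suc q) q (gap-> ℕ.≤-refl)))
      where
      des-F : ∀ i j → Φ (+ des (insertCycle i j v)) ≡ F (toℕ i) (toℕ j)
      des-F i j = cases (ℕ.<-cmp (toℕ i) (toℕ j))
        where
        open DesInsert v i j using (P; Q; z; des-insertCycle-<; des-insertCycle->; des-insertCycle-≡; des-insertCycle-≡suc)
        apart : ∀ {p} → P ≡ p → p ≢ Q → + des (insertCycle i j v) ≡ + des v + + 2 - z P Q - z Q P →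
          Φ (+ des (insertCycle i j v)) ≡ F (toℕ i) Q
        apart {p} refl p≢Q eq = trans (cong Φ (trans eq (cong (λ d → d + + 2 - z P Q - z Q P) (sym d≡des)))) (sym (F-apart (toℕ i) Q refl p≢Q))
        same : P ≡ Q → + des (insertCycle i j v) ≡ + des v + + 2 - z Q Q → Φ (+ des (insertCycle i j v)) ≡ F (toℕ i) Q
        same P≡Q eq = trans (cong Φ (trans eq (cong (λ d → d + + 2 - z Q Q) (sym d≡des)))) (sym (F-same (toℕ i) Q P≡Q))
        beyond : ∀ {p} → toℕ i ≡ suc p → Q ≤ p → Φ (+ des (insertCycle i j v)) ≡ F (toℕ i) Q
        beyond {p} i≡1+p Q≤p with ℕ.m≤n⇒m<n∨m≡n Q≤p
        ... | inj₁ Q<p  = apart (trans (gap-> (subst (Q <_) (sym i≡1+p) (ℕ.m<n⇒m<1+n Q<p))) (cong ℕ.pred i≡1+p))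
            (≢-sym (ℕ.<⇒≢ Q<p)) (des-insertCycle-> i≡1+p Q<p)
        ... | inj₂ refl = same (trans (gap-> (subst (Q <_) (sym i≡1+p) ℕ.≤-refl)) (cong ℕ.pred i≡1+p)) (des-insertCycle-≡suc i≡1+p)
        positive : ∀ {m n} → m < n → ∃ λ p → n ≡ suc p × m ≤ p
        positive (s≤s m≤p) = _ , refl , m≤p
        cases : _ → Φ (+ des (insertCycle i j v)) ≡ F (toℕ i) Q
        cases (tri< i<Q _ _) = apart (gap-≤ (ℕ.<⇒≤ i<Q)) (ℕ.<⇒≢ i<Q) (des-insertCycle-< i<Q)
        cases (tri≈ _ i≡Q _) = same (trans (gap-≤ (ℕ.≤-reflexive i≡Q)) i≡Q) (des-insertCycle-≡ i≡Q)
        cases (tri> _ _ Q<i) = let p , i≡1+p , Q≤p = positive Q<i in beyond i≡1+p Q≤p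

-- The numbers of insertions into an involution of length M with z descents that create 0, 1 and 2
-- new descents.
α β γ : ℤ → ℤ → ℤ
α M z = z * (z + 1ℤ) + M
β M z = + 2 * (z * (M - z) + 1ℤ)
γ M z = (M - z) * (M - z + 1ℤ) + M

at : ∀ (f : ℤ → ℤ) d z → f d * ⟦ d ℤ.≟ z ⟧ ≡ f z * ⟦ d ℤ.≟ z ⟧
at f d z with d ℤ.≟ z
... | yes refl = refl
... | no  _    = trans (ℤ.*-zeroʳ (f d)) (sym (ℤ.*-zeroʳ (f z)))

⟦+≟⟧ : ∀ d e z → ⟦ d + e ℤ.≟ z ⟧ ≡ ⟦ d ℤ.≟ z - e ⟧
⟦+≟⟧ d e z = ⟦⟧-cong (d + e ℤ.≟ z) (d ℤ.≟ z - e)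
  (λ d+e≡z → trans (cancel d e) (cong (_- e) d+e≡z)) (λ d≡z-e → trans (cong (_+ e) d≡z-e) (cancel′ z e))
  where
  cancel : ∀ d e → d ≡ d + e - e
  cancel = solve-∀
  cancel′ : ∀ d e → d - e + e ≡ d
  cancel′ = solve-∀

-- Marked involutions with z descents are counted twice: by their M+2 possible marks, and by the
-- smaller involution together with the insertion data. The coefficients depend on the descents of
-- the smaller involution, hence their shifted arguments.
Jℤ-recurrence : ∀ M z → + suc (suc M) * Jℤ (suc (suc M)) z ≡
  α (+ M) z * Jℤ M z + β (+ M) (z - 1ℤ) * Jℤ M (z - 1ℤ) + γ (+ M) (z - + 2) * Jℤ M (z - + 2)
Jℤ-recurrence M z = begin
  + suc (suc M) * Jℤ (suc (suc M)) z
    ≡⟨ ∑ₗ-*ˡ (involutions (suc (suc M))) (+ suc (suc M)) (λ π → Φ (+ des π)) ⟨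
  ∑ₗ (involutions (suc (suc M))) (λ π → + suc (suc M) * Φ (+ des π))
    ≡⟨ ∑ₗ-cong (involutions (suc (suc M))) (λ {π} _ → trans (∑ₗ-const (allFin (suc (suc M))) (Φ (+ des π)))
        (cong (λ n → + n * Φ (+ des π)) (List.length-tabulate {n = suc (suc M)} id))) ⟨
  ∑ₗ (involutions (suc (suc M))) (λ π → ∑ₗ (allFin (suc (suc M))) (λ _ → Φ (+ des π)))
    ≡⟨ ∑ₗ-cartesianProduct (involutions (suc (suc M))) (allFin (suc (suc M))) (λ (π , _) → Φ (+ des π)) ⟨
  ∑ₗ (marked (suc (suc M))) (λ (π , _) → Φ (+ des π))
    ≡⟨ trans (∑ₗ-↭ (λ (π , _) → Φ (+ des π)) (marked↭insertions M)) (∑ₗ-map insertMarked (insertions M) (λ (π , _) → Φ (+ des π))) ⟩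
  ∑ₗ (insertions M) (λ (v , j , i) → Φ (+ des (insertCycle i j v)))
    ≡⟨ ∑ₗ-cartesianProduct (involutions M) _ (λ (v , j , i) → Φ (+ des (insertCycle i j v))) ⟩
  ∑ₗ (involutions M) (λ v → ∑ₗ (cartesianProduct (allFin (suc M)) (allFin (suc (suc M)))) (λ (j , i) → Φ (+ des (insertCycle i j v))))
    ≡⟨ ∑ₗ-cong (involutions M) (λ {v} v∈ → trans
         (∑ₗ-cartesianProduct (allFin (suc M)) (allFin (suc (suc M))) (λ (j , i) → Φ (+ des (insertCycle i j v))))
         (trans (InsertionCount.∑-insertCycle v (∈-involutions⁻ v∈) Φ) (localise (InsertionCount.d≡des v (∈-involutions⁻ v∈))))) ⟩
  ∑ₗ (involutions M) (λ v → α (+ M) z * ⟦ + des v ℤ.≟ z ⟧ + β (+ M) (z - 1ℤ) * ⟦ + des v ℤ.≟ z - 1ℤ ⟧ + γ (+ M) (z - + 2) * ⟦ + des v ℤ.≟ z - + 2 ⟧)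
    ≡⟨ trans (∑ₗ-+ (involutions M) _ _) (cong₂ _+_ (trans (∑ₗ-+ (involutions M) _ _) (cong₂ _+_
         (∑ₗ-*ˡ (involutions M) (α (+ M) z) (λ v → ⟦ + des v ℤ.≟ z ⟧))
         (∑ₗ-*ˡ (involutions M) (β (+ M) (z - 1ℤ)) (λ v → ⟦ + des v ℤ.≟ z - 1ℤ ⟧))))
         (∑ₗ-*ˡ (involutions M) (γ (+ M) (z - + 2)) (λ v → ⟦ + des v ℤ.≟ z - + 2 ⟧))) ⟩
  α (+ M) z * Jℤ M z + β (+ M) (z - 1ℤ) * Jℤ M (z - 1ℤ) + γ (+ M) (z - + 2) * Jℤ M (z - + 2) ∎
  where
  open ≡-Reasoning
  Φ : ℤ → ℤ
  Φ e = ⟦ e ℤ.≟ z ⟧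
  localise : ∀ {d e} → d ≡ e →
    (d * (d + 1ℤ) + + M) * Φ d + + 2 * (d * (+ M - d) + 1ℤ) * Φ (d + 1ℤ) + ((+ M - d) * (+ M - d + 1ℤ) + + M) * Φ (d + + 2) ≡
    α (+ M) z * ⟦ e ℤ.≟ z ⟧ + β (+ M) (z - 1ℤ) * ⟦ e ℤ.≟ z - 1ℤ ⟧ + γ (+ M) (z - + 2) * ⟦ e ℤ.≟ z - + 2 ⟧
  localise {d} refl = cong₂ _+_ (cong₂ _+_
    (at (α (+ M)) d z)
    (trans (cong (β (+ M) d *_) (⟦+≟⟧ d 1ℤ z)) (at (β (+ M)) d (z - 1ℤ))))
    (trans (cong (γ (+ M) d *_) (⟦+≟⟧ d (+ 2) z)) (at (γ (+ M)) d (z - + 2)))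

-- Lucas coefficients and the recurrence for b

even-induction : (P : ℕ → Set) → P 0 → (∀ M → P M → P (suc (suc M))) → ∀ n → P (2 ℕ.* n)
even-induction P base step zero    = base
even-induction P base step (suc n) = subst P (sym (ℕ.*-suc 2 n)) (step (2 ℕ.* n) (even-induction P base step n))

-- Since γ M z = α M (M - z) and β M z = β M (M - z), reflecting z exchanges the outer terms of the
-- recurrence and keeps the middle one. The start is the empty involution, with 0 descents.
Jℤ-symmetric : ∀ n z → Jℤ (2 ℕ.* n) z ≡ Jℤ (2 ℕ.* n) (+ (2 ℕ.* n) - z)
Jℤ-symmetric = even-induction (λ M → ∀ z → Jℤ M z ≡ Jℤ M (+ M - z)) base step
  where
  base : ∀ z → Jℤ 0 z ≡ Jℤ 0 (0ℤ - z)
  base z = cong (λ s → s + 0ℤ) (⟦⟧-cong (0ℤ ℤ.≟ z) (0ℤ ℤ.≟ 0ℤ - z)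
    (λ 0≡z → subst (λ w → 0ℤ ≡ 0ℤ - w) 0≡z refl)
    (λ 0≡-z → trans (cong (λ w → 0ℤ - w) 0≡-z) (double-negation z)))
    where
    double-negation : ∀ z → 0ℤ - (0ℤ - z) ≡ z
    double-negation = solve-∀
  step : ∀ M → (∀ z → Jℤ M z ≡ Jℤ M (+ M - z)) → ∀ z → Jℤ (suc (suc M)) z ≡ Jℤ (suc (suc M)) (+ suc (suc M) - z)
  step M ih z = ℤ.*-cancelˡ-≡ (+ suc (suc M)) _ _ (begin
    + suc (suc M) * Jℤ (suc (suc M)) z
      ≡⟨ Jℤ-recurrence M z ⟩
    α (+ M) z * Jℤ M z + β (+ M) (z - 1ℤ) * Jℤ M (z - 1ℤ) + γ (+ M) (z - + 2) * Jℤ M (z - + 2)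
      ≡⟨ cong₂ _+_ (cong₂ _+_ (cong (α (+ M) z *_) (mirror z (w - + 2) (index₀ (+ M) z)))
          (cong (β (+ M) (z - 1ℤ) *_) (mirror (z - 1ℤ) (w - 1ℤ) (index₁ (+ M) z))))
          (cong (γ (+ M) (z - + 2) *_) (mirror (z - + 2) w (index₂ (+ M) z))) ⟩
    α (+ M) z * Jℤ M (w - + 2) + β (+ M) (z - 1ℤ) * Jℤ M (w - 1ℤ) + γ (+ M) (z - + 2) * Jℤ M w
      ≡⟨ coefficients (+ M) z (Jℤ M w) (Jℤ M (w - 1ℤ)) (Jℤ M (w - + 2)) ⟩
    α (+ M) w * Jℤ M w + β (+ M) (w - 1ℤ) * Jℤ M (w - 1ℤ) + γ (+ M) (w - + 2) * Jℤ M (w - + 2)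
      ≡⟨ Jℤ-recurrence M w ⟨
    + suc (suc M) * Jℤ (suc (suc M)) w ∎)
    where
    open ≡-Reasoning
    w : ℤ
    w = + suc (suc M) - z
    mirror : ∀ x y → + M - x ≡ y → Jℤ M x ≡ Jℤ M y
    mirror x y eq = trans (ih x) (cong (Jℤ M) eq)
    index₀ : ∀ M z → M - z ≡ + 2 + M - z - + 2
    index₀ = solve-∀
    index₁ : ∀ M z → M - (z - 1ℤ) ≡ + 2 + M - z - 1ℤ
    index₁ = solve-∀
    index₂ : ∀ M z → M - (z - + 2) ≡ + 2 + M - z
    index₂ = solve-∀
    coefficients : ∀ M z a b c → let w = + 2 + M - z in
      (z * (z + 1ℤ) + M) * c + + 2 * ((z - 1ℤ) * (M - (z - 1ℤ)) + 1ℤ) * b + ((M - (z - + 2)) * (M - (z - + 2) + 1ℤ) + M) * a ≡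
      (w * (w + 1ℤ) + M) * a + + 2 * ((w - 1ℤ) * (M - (w - 1ℤ)) + 1ℤ) * b + ((M - (w - + 2)) * (M - (w - + 2) + 1ℤ) + M) * c
    coefficients = solve-∀

-- At z = 0 the recurrence reads (M+2) J_{M+2,0} = M J_{M,0}, so M J_{M,0} keeps its value 0 from M
-- = 0. This matters because the sums in b start at i = 1.
Jℤ-at-0 : ∀ n → Jℤ (2 ℕ.* suc n) 0ℤ ≡ 0ℤ
Jℤ-at-0 n = ℤ.*-cancelˡ-≡ (+ (2 ℕ.* suc n)) _ _ (trans (even-induction (λ M → + M * Jℤ M 0ℤ ≡ 0ℤ) refl step (suc n))
    (sym (ℤ.*-zeroʳ (+ (2 ℕ.* suc n)))))
  where
  step : ∀ M → + M * Jℤ M 0ℤ ≡ 0ℤ → + suc (suc M) * Jℤ (suc (suc M)) 0ℤ ≡ 0ℤ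
  step M ih = begin
    + suc (suc M) * Jℤ (suc (suc M)) 0ℤ
      ≡⟨ Jℤ-recurrence M 0ℤ ⟩
    α (+ M) 0ℤ * Jℤ M 0ℤ + β (+ M) -1ℤ * Jℤ M -1ℤ + γ (+ M) -[1+ 1 ] * Jℤ M -[1+ 1 ]
      ≡⟨ cong₂ (λ s t → α (+ M) 0ℤ * Jℤ M 0ℤ + β (+ M) -1ℤ * s + γ (+ M) -[1+ 1 ] * t) (Jℤ-negative M 0) (Jℤ-negative M 1) ⟩
    α (+ M) 0ℤ * Jℤ M 0ℤ + β (+ M) -1ℤ * 0ℤ + γ (+ M) -[1+ 1 ] * 0ℤ
      ≡⟨ simplify (+ M) (β (+ M) -1ℤ) (γ (+ M) -[1+ 1 ]) (Jℤ M 0ℤ) ⟩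
    + M * Jℤ M 0ℤ
      ≡⟨ ih ⟩
    0ℤ ∎
    where
    open ≡-Reasoning
    simplify : ∀ M b c j → (0ℤ * (0ℤ + 1ℤ) + M) * j + b * 0ℤ + c * 0ℤ ≡ M * j
    simplify = solve-∀

-- Factorial form of the Lucas coefficients

C-! : ∀ s p → + ((s ℕ.+ p) C p) * (+ (p !) * + (s !)) ≡ + ((s ℕ.+ p) !)
C-! s p = begin
  + ((s ℕ.+ p) C p) * (+ (p !) * + (s !))     ≡⟨ cong (+ ((s ℕ.+ p) C p) *_) (ℤ.pos-* (p !) (s !)) ⟨
  + ((s ℕ.+ p) C p) * + (p ! ℕ.* s !)         ≡⟨ ℤ.pos-* ((s ℕ.+ p) C p) (p ! ℕ.* s !) ⟨
  + (((s ℕ.+ p) C p) ℕ.* (p ! ℕ.* s !))         ≡⟨ cong (λ t → + (((s ℕ.+ p) C p) ℕ.* (p ! ℕ.* t !))) (ℕ.m+n∸n≡m s p) ⟨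
  + (((s ℕ.+ p) C p) ℕ.* (p ! ℕ.* (s ℕ.+ p ∸ p) !)) ≡⟨ cong (λ c → + (c ℕ.* (p ! ℕ.* (s ℕ.+ p ∸ p) !))) (nCk≡n!/k![n-k]! p≤s+p) ⟩
  _                                           ≡⟨ cong (λ t → + t) (m/n*n≡m {{p ℕ.!* (s ℕ.+ p ∸ p) !≢0}} (k![n∸k]!∣n! p≤s+p)) ⟩
  + ((s ℕ.+ p) !)                             ∎
  where
  open ≡-Reasoning
  p≤s+p : p ≤ s ℕ.+ p
  p≤s+p = ℕ.m≤n+m p s

*-cancel-! : ∀ p s {x y} → x * (+ (p !) * + (s !)) ≡ y * (+ (p !) * + (s !)) → x ≡ y
*-cancel-! p s {x} {y} eq = ℤ.*-cancelʳ-≡ x y (+ (p ! ℕ.* s !)) {{p ℕ.!* s !≢0}}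
  (trans (cong (x *_) (ℤ.pos-* (p !) (s !))) (trans eq (cong (y *_) (sym (ℤ.pos-* (p !) (s !))))))

-- The Lucas polynomial coefficients (s + 2p) / (s + p) · C(s + p, p).
L : ℕ → ℕ → ℤ
L s zero    = 1ℤ
L s (suc q) = + ((s ℕ.+ suc q) C suc q) + + ((s ℕ.+ q) C q)

+suc! : ∀ n → + (suc n !) ≡ (1ℤ + + n) * + (n !)
+suc! n = ℤ.pos-* (suc n) (n !)

s+suc! : ∀ s q → + ((s ℕ.+ suc q) !) ≡ (1ℤ + (+ s + + q)) * + ((s ℕ.+ q) !)
s+suc! s q = trans (cong (λ n → + (n !)) (ℕ.+-suc s q)) (+suc! (s ℕ.+ q))

-- Here n = s + p - 1: the denominator s + p of the coefficient cancels the last factor of (s+p)!.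
-- For p = q + 1 the two binomials contribute s + q + 1 and q + 1, which add up to s + 2p.
L-! : ∀ s p {n} → s ℕ.+ p ≡ suc n → L s p * (+ (p !) * + (s !)) ≡ (+ s + + 2 * + p) * + (n !)
L-! s zero {n} eq = begin
  1ℤ * (1ℤ * + (s !))            ≡⟨ cong (λ m → 1ℤ * (1ℤ * + (m !))) s≡1+n ⟩
  1ℤ * (1ℤ * + (suc n !))        ≡⟨ cong (λ f → 1ℤ * (1ℤ * f)) (+suc! n) ⟩
  1ℤ * (1ℤ * ((1ℤ + + n) * + (n !))) ≡⟨ lem (+ n) (+ (n !)) ⟩
  (+ suc n + + 2 * 0ℤ) * + (n !) ≡⟨ cong (λ m → (+ m + + 2 * 0ℤ) * + (n !)) s≡1+n ⟨
  (+ s + + 2 * 0ℤ) * + (n !)     ∎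
  where
  open ≡-Reasoning
  s≡1+n : s ≡ suc n
  s≡1+n = trans (sym (ℕ.+-identityʳ s)) eq
  lem : ∀ n f → 1ℤ * (1ℤ * ((1ℤ + n) * f)) ≡ (1ℤ + n + + 2 * 0ℤ) * f
  lem = solve-∀
L-! s (suc q) {n} eq = begin
  (c₁ + c₀) * (+ (suc q !) * + (s !))                                ≡⟨ ℤ.*-distribʳ-+ (+ (suc q !) * + (s !)) c₁ c₀ ⟩
  c₁ * (+ (suc q !) * + (s !)) + c₀ * (+ (suc q !) * + (s !))        ≡⟨ cong₂ _+_ (trans (C-! s (suc q)) (s+suc! s q))
      (cong (λ f → c₀ * (f * + (s !))) (+suc! q)) ⟩
  (1ℤ + (+ s + + q)) * + ((s ℕ.+ q) !) + c₀ * ((1ℤ + + q) * + (q !) * + (s !))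
    ≡⟨ lem₁ (+ s) (+ q) (+ ((s ℕ.+ q) !)) c₀ (+ (q !)) (+ (s !)) ⟩
  (1ℤ + (+ s + + q)) * + ((s ℕ.+ q) !) + (1ℤ + + q) * (c₀ * (+ (q !) * + (s !)))
    ≡⟨ cong (λ f → (1ℤ + (+ s + + q)) * + ((s ℕ.+ q) !) + (1ℤ + + q) * f) (C-! s q) ⟩
  (1ℤ + (+ s + + q)) * + ((s ℕ.+ q) !) + (1ℤ + + q) * + ((s ℕ.+ q) !)
    ≡⟨ lem₂ (+ s) (+ q) (+ ((s ℕ.+ q) !)) ⟩
  (+ s + + 2 * + suc q) * + ((s ℕ.+ q) !)
    ≡⟨ cong (λ m → (+ s + + 2 * + suc q) * + (m !)) (ℕ.suc-injective (trans (sym (ℕ.+-suc s q)) eq)) ⟩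
  (+ s + + 2 * + suc q) * + (n !) ∎
  where
  open ≡-Reasoning
  c₁ c₀ : ℤ
  c₁ = + ((s ℕ.+ suc q) C suc q)
  c₀ = + ((s ℕ.+ q) C q)
  lem₁ : ∀ s q f c x y → (1ℤ + (s + q)) * f + c * ((1ℤ + q) * x * y) ≡ (1ℤ + (s + q)) * f + (1ℤ + q) * (c * (x * y))
  lem₁ = solve-∀
  lem₂ : ∀ s q f → (1ℤ + (s + q)) * f + (1ℤ + q) * f ≡ (s + + 2 * (1ℤ + q)) * f
  lem₂ = solve-∀

-- The cross-multiplied form of the quotient in `term`; it identifies the rational coefficient there
-- with the integer `L s p`.
L-C : ∀ s p → (+ s + + 2 * + p) * + ((s ℕ.+ p) C p) ≡ L s p * + (s ℕ.+ p)
L-C s p = cases (s ℕ.+ p) refl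
  where
  open ≡-Reasoning
  cases : ∀ n → s ℕ.+ p ≡ n → (+ s + + 2 * + p) * + ((s ℕ.+ p) C p) ≡ L s p * + (s ℕ.+ p)
  cases zero eq with ℕ.m+n≡0⇒m≡0 s eq | ℕ.m+n≡0⇒n≡0 s eq
  ... | refl | refl = refl
  cases (suc n) eq = *-cancel-! p s (begin
    (+ s + + 2 * + p) * + ((s ℕ.+ p) C p) * (+ (p !) * + (s !))   ≡⟨ ℤ.*-assoc (+ s + + 2 * + p) _ _ ⟩
    (+ s + + 2 * + p) * (+ ((s ℕ.+ p) C p) * (+ (p !) * + (s !))) ≡⟨ cong ((+ s + + 2 * + p) *_)
        (trans (C-! s p) (trans (cong (λ m → + (m !)) eq) (ℤ.pos-* (suc n) (n !)))) ⟩
    (+ s + + 2 * + p) * (+ suc n * + (n !))                       ≡⟨ lem (+ s + + 2 * + p) (+ suc n) (+ (n !)) ⟩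
    (+ s + + 2 * + p) * + (n !) * + suc n                         ≡⟨ cong₂ (λ x m → x * + m) (L-! s p eq) eq ⟨
    L s p * (+ (p !) * + (s !)) * + (s ℕ.+ p)                     ≡⟨ lem′ (L s p) (+ (p !) * + (s !)) (+ (s ℕ.+ p)) ⟩
    L s p * + (s ℕ.+ p) * (+ (p !) * + (s !))                     ∎)
    where
    lem : ∀ x n f → x * (n * f) ≡ x * f * n
    lem = solve-∀
    lem′ : ∀ x n f → x * n * f ≡ x * f * n
    lem′ = solve-∀

L-1 : ∀ s → L s 1 ≡ + s + + 2
L-1 s = trans (cong (λ c → + c + 1ℤ) (nC1≡n (s ℕ.+ 1))) (trans (cong (_+ 1ℤ) (ℤ.pos-+ s 1)) (lem (+ s)))
  where
  lem : ∀ s → s + 1ℤ + 1ℤ ≡ s + + 2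
  lem = solve-∀

L-0-suc : ∀ q → L 0 (suc q) ≡ + 2
L-0-suc q = cong₂ (λ x y → + x + + y) (nCn≡1 (suc q)) (nCn≡1 q)

-- Needed for k = n, where the term b_{2n-2,n-2} carries the exponent 2 of 1 + t.
L-2 : ∀ q → L 2 q ≡ (1ℤ + + q) * (1ℤ + + q)
L-2 q = *-cancel-! q 2 (begin
  L 2 q * (+ (q !) * + 2)              ≡⟨ L-! 2 q refl ⟩
  (+ 2 + + 2 * + q) * + (suc q !)      ≡⟨ cong ((+ 2 + + 2 * + q) *_) (+suc! q) ⟩
  (+ 2 + + 2 * + q) * ((1ℤ + + q) * + (q !)) ≡⟨ lem (+ q) (+ (q !)) ⟩
  (1ℤ + + q) * (1ℤ + + q) * (+ (q !) * + 2) ∎)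
  where
  open ≡-Reasoning
  lem : ∀ q f → (+ 2 + + 2 * q) * ((1ℤ + q) * f) ≡ (1ℤ + q) * (1ℤ + q) * (f * + 2)
  lem = solve-∀

c : ℕ → ℕ → ℤ
c s p = -1ℤ ^ p * L s p

prev : (ℕ → ℤ) → ℕ → ℤ
prev f zero    = 0ℤ
prev f (suc p) = f p

module _ (t q : ℕ) (k : ℤ) where

  private
    T Q M s z α′ β′ γ′ κ₀ κ₁ κ₂ L₁ L₂ L₃ L₄ L₅ T! Q! G : ℤ
    T  = + t
    Q  = + q
    M  = T + + 2 * k
    s  = + 2 + T
    z  = k - (+ 2 + Q)
    α′ = α M z
    β′ = β M z
    γ′ = γ M z
    κ₀ = α M k
    κ₁ = + 2 + + 2 * (k - 1ℤ) * (+ 2 * s - + 3)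
    κ₂ = + 4 * (s + + 2) * (s + 1ℤ)
    L₁ = L (2 ℕ.+ t) (2 ℕ.+ q)
    L₂ = L (2 ℕ.+ t) (1 ℕ.+ q)
    L₃ = L (2 ℕ.+ t) q
    L₄ = L t (2 ℕ.+ q)
    L₅ = L (4 ℕ.+ t) q
    T! = + (t !)
    Q! = + (q !)
    G  = + (suc (t ℕ.+ q) !)

    +2+! : ∀ n → + ((2 ℕ.+ n) !) ≡ (+ 2 + + n) * ((1ℤ + + n) * + (n !))
    +2+! n = trans (+suc! (suc n)) (cong ((+ 2 + + n) *_) (+suc! n))

    t+suc-q t+2+q : ℕ
    t+suc-q = t ℕ.+ suc q
    t+2+q   = t ℕ.+ suc (suc q)

    t+2+q! : + (suc t+2+q !) ≡ (+ 3 + (T + Q)) * ((+ 2 + (T + Q)) * G)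
    t+2+q! = trans (cong (λ n → + (suc n !)) (trans (ℕ.+-suc t (suc q)) (cong suc (ℕ.+-suc t q)))) (+2+! (suc (t ℕ.+ q)))

    t+1+q! : + (suc t+suc-q !) ≡ (+ 2 + (T + Q)) * G
    t+1+q! = trans (cong (λ n → + (suc n !)) (ℕ.+-suc t q)) (+suc! (suc (t ℕ.+ q)))

    fact : ∀ s p {n p!′ s!′ n!′} → s ℕ.+ p ≡ suc n → + (p !) ≡ p!′ → + (s !) ≡ s!′ → + (n !) ≡ n!′ →
      L s p * (p!′ * s!′) ≡ (+ s + + 2 * + p) * n!′
    fact s p eq refl refl refl = L-! s p eq

    fact₁ : L₁ * ((+ 2 + Q) * ((1ℤ + Q) * Q!) * ((+ 2 + T) * ((1ℤ + T) * T!))) ≡ (+ 2 + T + + 2 * (+ 2 + Q)) *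
        ((+ 3 + (T + Q)) * ((+ 2 + (T + Q)) * G))
    fact₁ = fact (2 ℕ.+ t) (2 ℕ.+ q) refl (+2+! q) (+2+! t) t+2+q!

    fact₂ : L₂ * ((1ℤ + Q) * Q! * ((+ 2 + T) * ((1ℤ + T) * T!))) ≡ (+ 2 + T + + 2 * (1ℤ + Q)) * ((+ 2 + (T + Q)) * G)
    fact₂ = fact (2 ℕ.+ t) (1 ℕ.+ q) refl (+suc! q) (+2+! t) t+1+q!

    fact₃ : L₃ * (Q! * ((+ 2 + T) * ((1ℤ + T) * T!))) ≡ (+ 2 + T + + 2 * Q) * G
    fact₃ = fact (2 ℕ.+ t) q refl refl (+2+! t) refl

    fact₄ : L₄ * ((+ 2 + Q) * ((1ℤ + Q) * Q!) * T!) ≡ (T + + 2 * (+ 2 + Q)) * G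
    fact₄ = fact t (2 ℕ.+ q) (trans (ℕ.+-suc t (suc q)) (cong suc (ℕ.+-suc t q))) (+2+! q) refl refl

    fact₅ : L₅ * (Q! * ((+ 4 + T) * ((+ 3 + T) * ((+ 2 + T) * ((1ℤ + T) * T!))))) ≡ (+ 4 + T + + 2 * Q) * ((+ 3 + (T + Q)) * ((+ 2 + (T + Q)) * G))
    fact₅ = fact (4 ℕ.+ t) q refl refl (trans (+2+! (2 ℕ.+ t)) (cong (λ f → (+ 4 + T) * ((+ 3 + T) * f)) (+2+! t))) (+2+! (suc (t ℕ.+ q)))

  L-identity : α′ * L₁ - β′ * L₂ + γ′ * L₃ ≡ κ₀ * L₄ - κ₁ * L₂ + κ₂ * L₅
  L-identity = *-cancel-! (2 ℕ.+ q) (2 ℕ.+ t) (begin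
    (α′ * L₁ - β′ * L₂ + γ′ * L₃) * (+ ((2 ℕ.+ q) !) * + ((2 ℕ.+ t) !))
      ≡⟨ cong₂ (λ f g → (α′ * L₁ - β′ * L₂ + γ′ * L₃) * (f * g)) (+2+! q) (+2+! t) ⟩
    (α′ * L₁ - β′ * L₂ + γ′ * L₃) * ((+ 2 + Q) * ((1ℤ + Q) * Q!) * ((+ 2 + T) * ((1ℤ + T) * T!)))
      ≡⟨ distribute α′ β′ γ′ L₁ L₂ L₃ (+ 2 + Q) (1ℤ + Q) Q! ((+ 2 + T) * ((1ℤ + T) * T!)) ⟩
    α′ * (L₁ * ((+ 2 + Q) * ((1ℤ + Q) * Q!) * ((+ 2 + T) * ((1ℤ + T) * T!)))) - β′ * (+ 2 + Q) *
        (L₂ * ((1ℤ + Q) * Q! * ((+ 2 + T) * ((1ℤ + T) * T!)))) + γ′ * ((+ 2 + Q) * (1ℤ + Q)) *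
        (L₃ * (Q! * ((+ 2 + T) * ((1ℤ + T) * T!))))
      ≡⟨ cong₂ _+_ (cong₂ (λ x y → α′ * x - β′ * (+ 2 + Q) * y) fact₁ fact₂) (cong (γ′ * ((+ 2 + Q) * (1ℤ + Q)) *_) fact₃) ⟩
    α′ * ((+ 2 + T + + 2 * (+ 2 + Q)) * ((+ 3 + (T + Q)) * ((+ 2 + (T + Q)) * G))) - β′ * (+ 2 + Q) *
        ((+ 2 + T + + 2 * (1ℤ + Q)) * ((+ 2 + (T + Q)) * G)) + γ′ * ((+ 2 + Q) * (1ℤ + Q)) * ((+ 2 + T + + 2 * Q) * G)
      ≡⟨ polynomial T Q k G ⟩
    -- G = (t+q+1)! is the smallest factorial (s+p-1)! among the five coefficients. The factors
    -- (s+2)(s+1) = (t+4)(t+3) of κ₂ turn (t+2)! into the (t+4)! that L₅ requires, so only the 4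
    -- stays in front.
    κ₀ * ((+ 2 + T) * (1ℤ + T)) * ((T + + 2 * (+ 2 + Q)) * G) - κ₁ * (+ 2 + Q) *
        ((+ 2 + T + + 2 * (1ℤ + Q)) * ((+ 2 + (T + Q)) * G)) + + 4 * ((+ 2 + Q) * (1ℤ + Q)) *
        ((+ 4 + T + + 2 * Q) * ((+ 3 + (T + Q)) * ((+ 2 + (T + Q)) * G)))
      ≡⟨ cong₂ _+_ (cong₂ (λ x y → κ₀ * ((+ 2 + T) * (1ℤ + T)) * x - κ₁ * (+ 2 + Q) * y) fact₄ fact₂) (cong (+ 4 * ((+ 2 + Q) * (1ℤ + Q)) *_) fact₅) ⟨
    κ₀ * ((+ 2 + T) * (1ℤ + T)) * (L₄ * ((+ 2 + Q) * ((1ℤ + Q) * Q!) * T!)) - κ₁ * (+ 2 + Q) *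
        (L₂ * ((1ℤ + Q) * Q! * ((+ 2 + T) * ((1ℤ + T) * T!)))) + + 4 * ((+ 2 + Q) * (1ℤ + Q)) *
        (L₅ * (Q! * ((+ 4 + T) * ((+ 3 + T) * ((+ 2 + T) * ((1ℤ + T) * T!))))))
      ≡⟨ collect κ₀ κ₁ L₄ L₂ L₅ (+ 2 + Q) (1ℤ + Q) Q! T T! ⟩
    (κ₀ * L₄ - κ₁ * L₂ + κ₂ * L₅) * ((+ 2 + Q) * ((1ℤ + Q) * Q!) * ((+ 2 + T) * ((1ℤ + T) * T!)))
      ≡⟨ cong₂ (λ f g → (κ₀ * L₄ - κ₁ * L₂ + κ₂ * L₅) * (f * g)) (+2+! q) (+2+! t) ⟨
    (κ₀ * L₄ - κ₁ * L₂ + κ₂ * L₅) * (+ ((2 ℕ.+ q) !) * + ((2 ℕ.+ t) !)) ∎)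
    where
    open ≡-Reasoning
    distribute : ∀ a b c x y z q₂ q₁ f g →
      (a * x - b * y + c * z) * (q₂ * (q₁ * f) * g) ≡
      a * (x * (q₂ * (q₁ * f) * g)) - b * q₂ * (y * (q₁ * f * g)) + c * (q₂ * q₁) * (z * (f * g))
    distribute = solve-∀
    collect : ∀ a b x y z q₂ q₁ f t g → let κ₂ = + 4 * (+ 2 + t + + 2) * (+ 2 + t + 1ℤ) in
      a * ((+ 2 + t) * (1ℤ + t)) * (x * (q₂ * (q₁ * f) * g)) - b * q₂ * (y * (q₁ * f * ((+ 2 + t) * ((1ℤ + t) * g)))) + + 4 *
          (q₂ * q₁) * (z * (f * ((+ 4 + t) * ((+ 3 + t) * ((+ 2 + t) * ((1ℤ + t) * g)))))) ≡
      (a * x - b * y + κ₂ * z) * (q₂ * (q₁ * f) * ((+ 2 + t) * ((1ℤ + t) * g)))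
    collect = solve-∀
    polynomial : ∀ T Q k G →
      let M = T + + 2 * k
          s = + 2 + T
          z = k - (+ 2 + Q)
          α′ = z * (z + 1ℤ) + M
          β′ = + 2 * (z * (M - z) + 1ℤ)
          γ′ = (M - z) * (M - z + 1ℤ) + M
          κ₀ = k * (k + 1ℤ) + M
          κ₁ = + 2 + + 2 * (k - 1ℤ) * (+ 2 * s - + 3)
      in
      α′ * ((+ 2 + T + + 2 * (+ 2 + Q)) * ((+ 3 + (T + Q)) * ((+ 2 + (T + Q)) * G))) - β′ * (+ 2 + Q) *
          ((+ 2 + T + + 2 * (1ℤ + Q)) * ((+ 2 + (T + Q)) * G)) + γ′ * ((+ 2 + Q) * (1ℤ + Q)) * ((+ 2 + T + + 2 * Q) * G) ≡
      κ₀ * ((+ 2 + T) * (1ℤ + T)) * ((T + + 2 * (+ 2 + Q)) * G) - κ₁ * (+ 2 + Q) *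
          ((+ 2 + T + + 2 * (1ℤ + Q)) * ((+ 2 + (T + Q)) * G)) + + 4 * ((+ 2 + Q) * (1ℤ + Q)) *
          ((+ 4 + T + + 2 * Q) * ((+ 3 + (T + Q)) * ((+ 2 + (T + Q)) * G)))
    polynomial = solve-∀

-- With M = 2n - 2 and s = 2n - 2k, the two sides are the coefficients of J_{2n-2,k-p} in
-- 2n·b_{2n,k} and in the right-hand side of the recurrence. The cases p = 0 and p = 1 are separate
-- since terms of `prev` drop out.
c-identity : ∀ t k p → let M = + t + + 2 * k ; s = + 2 + + t ; z = k - + p in
  α M z * c (2 ℕ.+ t) p + β M z * prev (c (2 ℕ.+ t)) p + γ M z * prev (prev (c (2 ℕ.+ t))) p ≡
  α M k * c t p + (+ 2 + + 2 * (k - 1ℤ) * (+ 2 * s - + 3)) * prev (c (2 ℕ.+ t)) p + + 4 * (s + + 2) * (s + 1ℤ) * prev (prev (c (4 ℕ.+ t))) p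
c-identity t k zero = lem (+ t) k
  where
  lem : ∀ t k → let M = t + + 2 * k ; s = + 2 + t ; z = k - 0ℤ in
    (z * (z + 1ℤ) + M) * 1ℤ + + 2 * (z * (M - z) + 1ℤ) * 0ℤ + ((M - z) * (M - z + 1ℤ) + M) * 0ℤ ≡
    (k * (k + 1ℤ) + M) * 1ℤ + (+ 2 + + 2 * (k - 1ℤ) * (+ 2 * s - + 3)) * 0ℤ + + 4 * (s + + 2) * (s + 1ℤ) * 0ℤ
  lem = solve-∀
c-identity t k (suc zero) = begin
  α M z * (-1ℤ * L (2 ℕ.+ t) 1) + β M z * 1ℤ + γ M z * 0ℤ
    ≡⟨ cong (λ l → α M z * (-1ℤ * l) + β M z * 1ℤ + γ M z * 0ℤ) (L-1 (2 ℕ.+ t)) ⟩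
  α M z * (-1ℤ * (s + + 2)) + β M z * 1ℤ + γ M z * 0ℤ
    ≡⟨ lem (+ t) k ⟩
  α M k * (-1ℤ * (+ t + + 2)) + κ₁ * 1ℤ + κ₂ * 0ℤ
    ≡⟨ cong (λ l → α M k * (-1ℤ * l) + κ₁ * 1ℤ + κ₂ * 0ℤ) (L-1 t) ⟨
  α M k * (-1ℤ * L t 1) + κ₁ * 1ℤ + κ₂ * 0ℤ ∎
  where
  open ≡-Reasoning
  M s z κ₁ κ₂ : ℤ
  M  = + t + + 2 * k
  s  = + 2 + + t
  z  = k - 1ℤ
  κ₁ = + 2 + + 2 * (k - 1ℤ) * (+ 2 * s - + 3)
  κ₂ = + 4 * (s + + 2) * (s + 1ℤ)
  lem : ∀ t k → let M = t + + 2 * k ; s = + 2 + t ; z = k - 1ℤ in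
    (z * (z + 1ℤ) + M) * (-1ℤ * (s + + 2)) + + 2 * (z * (M - z) + 1ℤ) * 1ℤ + ((M - z) * (M - z + 1ℤ) + M) * 0ℤ ≡
    (k * (k + 1ℤ) + M) * (-1ℤ * (t + + 2)) + (+ 2 + + 2 * (k - 1ℤ) * (+ 2 * s - + 3)) * 1ℤ + + 4 * (s + + 2) * (s + 1ℤ) * 0ℤ
  lem = solve-∀
c-identity t k (suc (suc q)) = trans
  (signs (-1ℤ ^ q) (α M z) (β M z) (γ M z) (L (2 ℕ.+ t) (2 ℕ.+ q)) (L (2 ℕ.+ t) (1 ℕ.+ q)) (L (2 ℕ.+ t) q))
  (trans (cong (-1ℤ ^ (2 ℕ.+ q) *_) (L-identity t q k))
    (sym (signs (-1ℤ ^ q) (α M k) (+ 2 + + 2 * (k - 1ℤ) * (+ 2 * s - + 3)) (+ 4 * (s + + 2) * (s + 1ℤ)) (L t (2 ℕ.+ q))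
        (L (2 ℕ.+ t) (1 ℕ.+ q)) (L (4 ℕ.+ t) q))))
  where
  M s z : ℤ
  M = + t + + 2 * k
  s = + 2 + + t
  z = k - + (2 ℕ.+ q)
  signs : ∀ σ a b c x y z →
    a * (-1ℤ * (-1ℤ * σ) * x) + b * (-1ℤ * σ * y) + c * (σ * z) ≡ -1ℤ * (-1ℤ * σ) * (a * x - b * y + c * z)
  signs = solve-∀

-- Nothing is lost at either end: `prev g` vanishes at 0 and `h` at n. The length of the sum thus
-- stays the same, and shifted sums can be compared term by term.
∑-shift : ∀ n (g h : ℕ → ℤ) → h n ≡ 0ℤ → ∑[ p < n ] (g p * h (suc p)) ≡ ∑[ p < n ] (prev g p * h p)
∑-shift n g h hn≡0 = begin
  ∑[ p < n ] (g p * h (suc p))                    ≡⟨ ℤ.+-identityˡ _ ⟨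
  0ℤ + ∑[ p < n ] (g p * h (suc p))               ≡⟨ ∑-front n (λ p → prev g p * h p) ⟨
  ∑[ p < n ] (prev g p * h p) + prev g n * h n    ≡⟨ cong (λ x → ∑[ p < n ] (prev g p * h p) + prev g n * x) hn≡0 ⟩
  ∑[ p < n ] (prev g p * h p) + prev g n * 0ℤ     ≡⟨ cong (λ x → ∑[ p < n ] (prev g p * h p) + x) (ℤ.*-zeroʳ (prev g n)) ⟩
  ∑[ p < n ] (prev g p * h p) + 0ℤ                ≡⟨ ℤ.+-identityʳ _ ⟩
  ∑[ p < n ] (prev g p * h p)                     ∎
  where open ≡-Reasoning

-- The γ-coefficient b_{2m,k} is Γ f (2m - 2k) k n, where f = J_{2m} and n > k.
Γ : (ℤ → ℤ) → ℕ → ℤ → ℕ → ℤ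
Γ f s z n = ∑[ p < n ] (c s p * f (z - + p))

module _ (M : ℕ) (k : ℤ) (n : ℕ) (vanishes : ∀ p → n ≤ p → Jℤ M (k - + p) ≡ 0ℤ) where

  private
    e : ℕ → ℤ
    e p = Jℤ M (k - + p)

    minus-1 : ∀ k p → k - p - 1ℤ ≡ k - (1ℤ + p)
    minus-1 = solve-∀

    minus-2 : ∀ k p → k - p - + 2 ≡ k - (+ 2 + p)
    minus-2 = solve-∀

  Γ-expand : ∀ s → + suc (suc M) * Γ (Jℤ (suc (suc M))) s k n ≡
    ∑[ p < n ] ((α (+ M) (k - + p) * c s p + β (+ M) (k - + p) * prev (c s) p + γ (+ M) (k - + p) * prev (prev (c s)) p) * e p)
  Γ-expand s = begin
    + suc (suc M) * Γ (Jℤ (suc (suc M))) s k n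
      ≡⟨ ∑-*ˡ n (+ suc (suc M)) (λ p → c s p * Jℤ (suc (suc M)) (k - + p)) ⟨
    ∑[ p < n ] (+ suc (suc M) * (c s p * Jℤ (suc (suc M)) (k - + p)))
      ≡⟨ ∑-cong n (λ {p} _ → recurrence p) ⟩
    ∑[ p < n ] (c s p * e₀ p + c s p * e₁ (suc p) + c s p * e₂ (suc (suc p)))
      ≡⟨ trans (∑-+ n (λ p → c s p * e₀ p + c s p * e₁ (suc p)) (λ p → c s p * e₂ (suc (suc p))))
          (cong (λ x → x + ∑[ p < n ] (c s p * e₂ (suc (suc p)))) (∑-+ n (λ p → c s p * e₀ p) (λ p → c s p * e₁ (suc p)))) ⟩
    ∑[ p < n ] (c s p * e₀ p) + ∑[ p < n ] (c s p * e₁ (suc p)) + ∑[ p < n ] (c s p * e₂ (suc (suc p)))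
      ≡⟨ cong₂ (λ x y → ∑[ p < n ] (c s p * e₀ p) + x + y) (∑-shift n (c s) e₁ e₁-vanishes)
           (trans (∑-shift n (c s) (λ p → e₂ (suc p)) (e₂-vanishes (suc n) (ℕ.n≤1+n n))) (∑-shift n (prev (c s)) e₂ (e₂-vanishes n ℕ.≤-refl))) ⟩
    ∑[ p < n ] (c s p * e₀ p) + ∑[ p < n ] (prev (c s) p * e₁ p) + ∑[ p < n ] (prev (prev (c s)) p * e₂ p)
      ≡⟨ trans (∑-+ n (λ p → c s p * e₀ p + prev (c s) p * e₁ p) (λ p → prev (prev (c s)) p * e₂ p))
          (cong (λ x → x + ∑[ p < n ] (prev (prev (c s)) p * e₂ p)) (∑-+ n (λ p → c s p * e₀ p) (λ p → prev (c s) p * e₁ p))) ⟨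
    ∑[ p < n ] (c s p * e₀ p + prev (c s) p * e₁ p + prev (prev (c s)) p * e₂ p)
      ≡⟨ ∑-cong n (λ {p} _ → factor (c s p) (prev (c s) p) (prev (prev (c s)) p) (α (+ M) (k - + p)) (β (+ M) (k - + p)) (γ (+ M) (k - + p)) (e p)) ⟩
    ∑[ p < n ] ((α (+ M) (k - + p) * c s p + β (+ M) (k - + p) * prev (c s) p + γ (+ M) (k - + p) * prev (prev (c s)) p) * e p) ∎
    where
    open ≡-Reasoning
    e₀ e₁ e₂ : ℕ → ℤ
    e₀ p = α (+ M) (k - + p) * e p
    e₁ p = β (+ M) (k - + p) * e p
    e₂ p = γ (+ M) (k - + p) * e p
    e₁-vanishes : e₁ n ≡ 0ℤ
    e₁-vanishes = trans (cong (β (+ M) (k - + n) *_) (vanishes n ℕ.≤-refl)) (ℤ.*-zeroʳ (β (+ M) (k - + n)))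
    e₂-vanishes : ∀ p → n ≤ p → e₂ p ≡ 0ℤ
    e₂-vanishes p n≤p = trans (cong (γ (+ M) (k - + p) *_) (vanishes p n≤p)) (ℤ.*-zeroʳ (γ (+ M) (k - + p)))
    rotate : ∀ n c j → n * (c * j) ≡ c * (n * j)
    rotate = solve-∀
    spread : ∀ c x y z → c * (x + y + z) ≡ c * x + c * y + c * z
    spread = solve-∀
    recurrence : ∀ p → + suc (suc M) * (c s p * Jℤ (suc (suc M)) (k - + p)) ≡ c s p * e₀ p + c s p * e₁ (suc p) + c s p * e₂ (suc (suc p))
    recurrence p = trans (rotate (+ suc (suc M)) (c s p) (Jℤ (suc (suc M)) (k - + p))) (trans
      (cong (c s p *_) (trans (Jℤ-recurrence M (k - + p)) (cong₂ (λ x y → e₀ p + β (+ M) x * Jℤ M x + γ (+ M) y * Jℤ M y)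
          (minus-1 k (+ p)) (minus-2 k (+ p)))))
      (spread (c s p) (e₀ p) (e₁ (suc p)) (e₂ (suc (suc p)))))
    factor : ∀ c₀ c₁ c₂ x y z e → c₀ * (x * e) + c₁ * (y * e) + c₂ * (z * e) ≡ (x * c₀ + y * c₁ + z * c₂) * e
    factor = solve-∀

  Γ-shift₁ : ∀ s → Γ (Jℤ M) s (k - 1ℤ) n ≡ ∑[ p < n ] (prev (c s) p * e p)
  Γ-shift₁ s = trans (∑-cong n (λ {p} _ → cong (λ z → c s p * Jℤ M z) (lem k (+ p)))) (∑-shift n (c s) e (vanishes n ℕ.≤-refl))
    where
    lem : ∀ k p → k - 1ℤ - p ≡ k - (1ℤ + p)
    lem = solve-∀

  Γ-shift₂ : ∀ s → Γ (Jℤ M) s (k - + 2) n ≡ ∑[ p < n ] (prev (prev (c s)) p * e p)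
  Γ-shift₂ s = trans (∑-cong n (λ {p} _ → cong (λ z → c s p * Jℤ M z) (lem k (+ p))))
    (trans (∑-shift n (c s) (e ∘ suc) (vanishes (suc n) (ℕ.n≤1+n n))) (∑-shift n (prev (c s)) e (vanishes n ℕ.≤-refl)))
    where
    lem : ∀ k p → k - + 2 - p ≡ k - (+ 2 + p)
    lem = solve-∀

  Γ-combine : ∀ x y z s₀ s₁ s₂ → x * Γ (Jℤ M) s₀ k n + y * Γ (Jℤ M) s₁ (k - 1ℤ) n + z * Γ (Jℤ M) s₂ (k - + 2) n ≡
    ∑[ p < n ] ((x * c s₀ p + y * prev (c s₁) p + z * prev (prev (c s₂)) p) * e p)
  Γ-combine x y z s₀ s₁ s₂ = begin
    x * Γ (Jℤ M) s₀ k n + y * Γ (Jℤ M) s₁ (k - 1ℤ) n + z * Γ (Jℤ M) s₂ (k - + 2) n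
      ≡⟨ cong₂ _+_ (cong₂ _+_ (sym (∑-*ˡ n x _)) (trans (cong (y *_) (Γ-shift₁ s₁)) (sym (∑-*ˡ n y _))))
          (trans (cong (z *_) (Γ-shift₂ s₂)) (sym (∑-*ˡ n z _))) ⟩
    ∑[ p < n ] (x * (c s₀ p * e p)) + ∑[ p < n ] (y * (prev (c s₁) p * e p)) + ∑[ p < n ] (z * (prev (prev (c s₂)) p * e p))
      ≡⟨ trans (∑-+ n _ _) (cong₂ _+_ (∑-+ n _ _) refl) ⟨
    ∑[ p < n ] (x * (c s₀ p * e p) + y * (prev (c s₁) p * e p) + z * (prev (prev (c s₂)) p * e p))
      ≡⟨ ∑-cong n (λ {p} _ → factor x y z (c s₀ p) (prev (c s₁) p) (prev (prev (c s₂)) p) (e p)) ⟩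
    ∑[ p < n ] ((x * c s₀ p + y * prev (c s₁) p + z * prev (prev (c s₂)) p) * e p) ∎
    where
    open ≡-Reasoning
    factor : ∀ x y z c₀ c₁ c₂ e → x * (c₀ * e) + y * (c₁ * e) + z * (c₂ * e) ≡ (x * c₀ + y * c₁ + z * c₂) * e
    factor = solve-∀

  -- The natural number t is 2n - 2 - 2k, so this covers k ≤ n - 1. Both sides are expanded in the
  -- same values `e p`, and their coefficients agree by `c-identity`.
  Γ-recurrence : ∀ t → + M ≡ + t + + 2 * k → let s = + 2 + + t in
    + suc (suc M) * Γ (Jℤ (suc (suc M))) (2 ℕ.+ t) k n ≡
      α (+ M) k * Γ (Jℤ M) t k n
      + (+ 2 + + 2 * (k - 1ℤ) * (+ 2 * s - + 3)) * Γ (Jℤ M) (2 ℕ.+ t) (k - 1ℤ) n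
      + + 4 * (s + + 2) * (s + 1ℤ) * Γ (Jℤ M) (4 ℕ.+ t) (k - + 2) n
  Γ-recurrence t M≡ = begin
    + suc (suc M) * Γ (Jℤ (suc (suc M))) (2 ℕ.+ t) k n
      ≡⟨ Γ-expand (2 ℕ.+ t) ⟩
    ∑[ p < n ] ((α (+ M) (k - + p) * c (2 ℕ.+ t) p + β (+ M) (k - + p) * prev (c (2 ℕ.+ t)) p + γ (+ M) (k - + p) * prev
        (prev (c (2 ℕ.+ t))) p) * e p)
      ≡⟨ ∑-cong n (λ {p} _ → cong (_* e p) (identity p)) ⟩
    ∑[ p < n ] ((α (+ M) k * c t p + κ₁ * prev (c (2 ℕ.+ t)) p + κ₂ * prev (prev (c (4 ℕ.+ t))) p) * e p)
      ≡⟨ Γ-combine (α (+ M) k) κ₁ κ₂ t (2 ℕ.+ t) (4 ℕ.+ t) ⟨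
    α (+ M) k * Γ (Jℤ M) t k n + κ₁ * Γ (Jℤ M) (2 ℕ.+ t) (k - 1ℤ) n + κ₂ * Γ (Jℤ M) (4 ℕ.+ t) (k - + 2) n ∎
    where
    open ≡-Reasoning
    κ₁ κ₂ : ℤ
    κ₁ = + 2 + + 2 * (k - 1ℤ) * (+ 2 * (+ 2 + + t) - + 3)
    κ₂ = + 4 * (+ 2 + + t + + 2) * (+ 2 + + t + 1ℤ)
    identity : ∀ p → α (+ M) (k - + p) * c (2 ℕ.+ t) p + β (+ M) (k - + p) * prev (c (2 ℕ.+ t)) p + γ (+ M) (k - + p) * prev (prev (c (2 ℕ.+ t))) p ≡
      α (+ M) k * c t p + κ₁ * prev (c (2 ℕ.+ t)) p + κ₂ * prev (prev (c (4 ℕ.+ t))) p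
    identity p = subst (λ m → α m (k - + p) * c (2 ℕ.+ t) p + β m (k - + p) * prev (c (2 ℕ.+ t)) p + γ m (k - + p) * prev (prev (c (2 ℕ.+ t))) p ≡
      α m k * c t p + κ₁ * prev (c (2 ℕ.+ t)) p + κ₂ * prev (prev (c (4 ℕ.+ t))) p) (sym M≡) (c-identity t k p)

+-∸-negative : ∀ {k p} → k < p → ∃ λ a → + k - + p ≡ -[1+ a ]
+-∸-negative {k} k<p with ℕ.m≤n⇒∃[o]m+o≡n k<p
... | a , refl = a , trans (cong (λ x → + k - (1ℤ + x)) (ℤ.pos-+ k a)) (lem (+ k) (+ a))
  where
  lem : ∀ k a → k - (1ℤ + (k + a)) ≡ - (1ℤ + a)
  lem = solve-∀

Jℤ-vanishes : ∀ M {k p} → k < p → Jℤ M (+ k - + p) ≡ 0ℤ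
Jℤ-vanishes M k<p with +-∸-negative k<p
... | a , eq = trans (cong (Jℤ M) eq) (Jℤ-negative M a)

-- For k = n the term b_{2n-2,k} is missing, and the symmetry of J_{2n-2} about n - 1 makes up for it.
Γ-recurrence-middle : ∀ j → let k = + (2 ℕ.+ j) ; M = 2 ℕ.* suc j in
  + suc (suc M) * Γ (Jℤ (suc (suc M))) 0 k (3 ℕ.+ j) ≡
    α (+ M) k * 0ℤ
    + (+ 2 + + 2 * (k - 1ℤ) * - + 3) * Γ (Jℤ M) 0 (k - 1ℤ) (3 ℕ.+ j)
    + + 8 * Γ (Jℤ M) 2 (k - + 2) (3 ℕ.+ j)
Γ-recurrence-middle j = begin
  + suc (suc M) * Γ (Jℤ (suc (suc M))) 0 k (3 ℕ.+ j)
    ≡⟨ Γ-expand M k (3 ℕ.+ j) (λ _ → Jℤ-vanishes M) 0 ⟩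
  ∑[ p < 3 ℕ.+ j ] (X p * e p)
    ≡⟨ trans (fronts (λ p → X p * e p)) (cong (λ x → X 0 * e 0 + (X 1 * e 1 + (X 2 * e 2 + x)))
        (∑-cong j (λ {p} _ → cong (_* e (3 ℕ.+ p)) (X-3 p)))) ⟩
  X 0 * e 0 + (X 1 * e 1 + (X 2 * e 2 + rest))
    ≡⟨ cong₂ (λ x y → X 0 * e 0 + (x * e 1 + (y * e 2 + rest))) X-1 X-2 ⟩
  X 0 * e 0 + (Y 1 * e 1 + ((Y 2 - X 0) * e 2 + rest))
    ≡⟨ cong (λ x → X 0 * x + (Y 1 * e 1 + ((Y 2 - X 0) * e 2 + rest))) e-0 ⟩
  X 0 * e 2 + (Y 1 * e 1 + ((Y 2 - X 0) * e 2 + rest))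
    ≡⟨ lem (X 0) (Y 1) (Y 2) (e 0) (e 1) (e 2) rest κ₁ ⟩
  Y 0 * e 0 + (Y 1 * e 1 + (Y 2 * e 2 + rest))
    ≡⟨ fronts (λ p → Y p * e p) ⟨
  ∑[ p < 3 ℕ.+ j ] (Y p * e p)
    ≡⟨ Γ-combine M k (3 ℕ.+ j) (λ _ → Jℤ-vanishes M) 0ℤ κ₁ (+ 8) 0 0 2 ⟨
  0ℤ * Γ (Jℤ M) 0 k (3 ℕ.+ j) + κ₁ * Γ (Jℤ M) 0 (k - 1ℤ) (3 ℕ.+ j) + + 8 * Γ (Jℤ M) 2 (k - + 2) (3 ℕ.+ j)
    ≡⟨ cong (λ x → x + κ₁ * Γ (Jℤ M) 0 (k - 1ℤ) (3 ℕ.+ j) + + 8 * Γ (Jℤ M) 2 (k - + 2) (3 ℕ.+ j)) (sym (ℤ.*-zeroʳ (α (+ M) k))) ⟩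
  α (+ M) k * 0ℤ + κ₁ * Γ (Jℤ M) 0 (k - 1ℤ) (3 ℕ.+ j) + + 8 * Γ (Jℤ M) 2 (k - + 2) (3 ℕ.+ j) ∎
  where
  open ≡-Reasoning
  M : ℕ
  M = 2 ℕ.* suc j
  k κ₁ : ℤ
  k  = + (2 ℕ.+ j)
  -- The general coefficients at s = 2n - 2k = 0: 2s - 3 becomes -3, and 4(s+2)(s+1) becomes 8.
  κ₁ = + 2 + + 2 * (k - 1ℤ) * - + 3
  e X Y : ℕ → ℤ
  e p = Jℤ M (k - + p)
  X p = α (+ M) (k - + p) * c 0 p + β (+ M) (k - + p) * prev (c 0) p + γ (+ M) (k - + p) * prev (prev (c 0)) p
  Y p = 0ℤ * c 0 p + κ₁ * prev (c 0) p + + 8 * prev (prev (c 2)) p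
  rest : ℤ
  rest = ∑[ p < j ] (Y (3 ℕ.+ p) * e (3 ℕ.+ p))
  M≡ : + M ≡ + 2 * k - + 2
  M≡ = trans (ℤ.pos-* 2 (suc j)) (arith (+ j))
    where
    arith : ∀ j → + 2 * (1ℤ + j) ≡ + 2 * (+ 2 + j) - + 2
    arith = solve-∀
  fronts : ∀ f → ∑ (3 ℕ.+ j) f ≡ f 0 + (f 1 + (f 2 + ∑[ p < j ] (f (3 ℕ.+ p))))
  fronts f = trans (∑-front (2 ℕ.+ j) f) (cong (λ x → f 0 + x) (trans (∑-front (suc j) (f ∘ suc)) (cong (λ x → f 1 + x) (∑-front j (f ∘ suc ∘ suc)))))
  e-0 : e 0 ≡ e 2
  e-0 = trans (Jℤ-symmetric (suc j) (k - 0ℤ)) (cong (Jℤ M) (trans (cong (_- (k - 0ℤ)) M≡) (arith k)))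
    where
    arith : ∀ k → + 2 * k - + 2 - (k - 0ℤ) ≡ k - + 2
    arith = solve-∀
  identity : ∀ p {x₀ x₁ x₂ y₂ r} → c 0 p ≡ x₀ → prev (c 0) p ≡ x₁ → prev (prev (c 0)) p ≡ x₂ → prev (prev (c 2)) p ≡ y₂ →
    (let m = + 2 * k - + 2 in α m (k - + p) * x₀ + β m (k - + p) * x₁ + γ m (k - + p) * x₂ ≡ 0ℤ * x₀ + κ₁ * x₁ + + 8 * y₂ - r) →
    X p ≡ Y p - r
  identity p refl refl refl refl eq = trans (cong (λ m → α m (k - + p) * c 0 p + β m (k - + p) * prev (c 0) p + γ m
      (k - + p) * prev (prev (c 0)) p) M≡) eq
  X-1 : X 1 ≡ Y 1
  X-1 = trans (identity 1 {x₂ = 0ℤ} {y₂ = 0ℤ} {r = 0ℤ} refl refl refl refl (arith k)) (ℤ.+-identityʳ (Y 1))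
    where
    arith : ∀ k → let M = + 2 * k - + 2 ; z = k - 1ℤ in
      (z * (z + 1ℤ) + M) * - + 2 + + 2 * (z * (M - z) + 1ℤ) * 1ℤ + ((M - z) * (M - z + 1ℤ) + M) * 0ℤ ≡
      0ℤ * - + 2 + (+ 2 + + 2 * (k - 1ℤ) * - + 3) * 1ℤ + + 8 * 0ℤ - 0ℤ
    arith = solve-∀
  -- The coefficients `X` and `Y` differ only at p = 0 and p = 2, by opposite amounts since `Y 0` is
  -- 0. As e 0 = e 2 by symmetry, the two discrepancies cancel.
  X-2 : X 2 ≡ Y 2 - X 0
  X-2 = identity 2 {r = X 0} refl refl refl refl (trans (arith k) (cong (λ m → 0ℤ * + 2 + κ₁ * - + 2 + + 8 * 1ℤ -
      (α m (k - 0ℤ) * 1ℤ + β m (k - 0ℤ) * 0ℤ + γ m (k - 0ℤ) * 0ℤ)) (sym M≡)))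
    where
    arith : ∀ k → let M = + 2 * k - + 2 ; z = k - + 2 ; w = k - 0ℤ in
      (z * (z + 1ℤ) + M) * + 2 + + 2 * (z * (M - z) + 1ℤ) * - + 2 + ((M - z) * (M - z + 1ℤ) + M) * 1ℤ ≡
      0ℤ * + 2 + (+ 2 + + 2 * (k - 1ℤ) * - + 3) * - + 2 + + 8 * 1ℤ
        - ((w * (w + 1ℤ) + M) * 1ℤ + + 2 * (w * (M - w) + 1ℤ) * 0ℤ + ((M - w) * (M - w + 1ℤ) + M) * 0ℤ)
    arith = solve-∀
  X-3 : ∀ r → X (3 ℕ.+ r) ≡ Y (3 ℕ.+ r)
  X-3 r = trans (identity (3 ℕ.+ r) {r = 0ℤ} (cong (-1ℤ ^ (3 ℕ.+ r) *_) (L-0-suc (2 ℕ.+ r)))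
      (cong (-1ℤ ^ (2 ℕ.+ r) *_) (L-0-suc (1 ℕ.+ r))) (cong (-1ℤ ^ (1 ℕ.+ r) *_) (L-0-suc r))
    (cong (-1ℤ ^ (1 ℕ.+ r) *_) (L-2 (suc r))) (arith k (+ r) (-1ℤ ^ r))) (ℤ.+-identityʳ (Y (3 ℕ.+ r)))
    where
    arith : ∀ k r σ → let M = + 2 * k - + 2 ; z = k - (+ 3 + r) in
      (z * (z + 1ℤ) + M) * (-1ℤ * (-1ℤ * (-1ℤ * σ)) * + 2) + + 2 * (z * (M - z) + 1ℤ) * (-1ℤ * (-1ℤ * σ) * + 2) +
          ((M - z) * (M - z + 1ℤ) + M) * (-1ℤ * σ * + 2) ≡
      0ℤ * (-1ℤ * (-1ℤ * (-1ℤ * σ)) * + 2) + (+ 2 + + 2 * (k - 1ℤ) * - + 3) * (-1ℤ * (-1ℤ * σ) * + 2) + + 8 *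
          (-1ℤ * σ * ((1ℤ + (1ℤ + r)) * (1ℤ + (1ℤ + r)))) - 0ℤ
    arith = solve-∀
  lem : ∀ x y z e₀ e₁ e₂ r κ → x * e₂ + (y * e₁ + ((z - x) * e₂ + r)) ≡ (0ℤ * 1ℤ + κ * 0ℤ + + 8 * 0ℤ) * e₀ + (y * e₁ + (z * e₂ + r))
  lem = solve-∀

-- The rational numbers `b` as images of integers

ι : ℤ → ℚ
ι z = z / 1

-- A quotient `z / suc q` is by definition `fromℚᵘ` of an unnormalised fraction, so calculations can
-- be moved to fractions whose arithmetic does no cancelling.
fromℚᵘ-+ : ∀ x y → fromℚᵘ x ℚ.+ fromℚᵘ y ≡ fromℚᵘ (x ℚᵘ.+ y)
fromℚᵘ-+ x y = ℚ.toℚᵘ-injective (ℚᵘ.≃-trans (ℚ.toℚᵘ-homo-+ (fromℚᵘ x) (fromℚᵘ y))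
  (ℚᵘ.≃-trans (ℚᵘ.+-cong (ℚ.toℚᵘ-fromℚᵘ x) (ℚ.toℚᵘ-fromℚᵘ y)) (ℚᵘ.≃-sym (ℚ.toℚᵘ-fromℚᵘ (x ℚᵘ.+ y)))))

fromℚᵘ-* : ∀ x y → fromℚᵘ x ℚ.* fromℚᵘ y ≡ fromℚᵘ (x ℚᵘ.* y)
fromℚᵘ-* x y = ℚ.toℚᵘ-injective (ℚᵘ.≃-trans (ℚ.toℚᵘ-homo-* (fromℚᵘ x) (fromℚᵘ y))
  (ℚᵘ.≃-trans (ℚᵘ.*-cong (ℚ.toℚᵘ-fromℚᵘ x) (ℚ.toℚᵘ-fromℚᵘ y)) (ℚᵘ.≃-sym (ℚ.toℚᵘ-fromℚᵘ (x ℚᵘ.* y)))))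

ι-+ : ∀ x y → ι x ℚ.+ ι y ≡ ι (x + y)
ι-+ x y = trans (fromℚᵘ-+ (mkℚᵘ x 0) (mkℚᵘ y 0)) (ℚ.fromℚᵘ-cong {mkℚᵘ x 0 ℚᵘ.+ mkℚᵘ y 0} {mkℚᵘ (x + y) 0} (*≡* (lem x y)))
  where
  lem : ∀ x y → (x * 1ℤ + y * 1ℤ) * 1ℤ ≡ (x + y) * 1ℤ
  lem = solve-∀

ι-* : ∀ x y → ι x ℚ.* ι y ≡ ι (x * y)
ι-* x y = trans (fromℚᵘ-* (mkℚᵘ x 0) (mkℚᵘ y 0)) (ℚ.fromℚᵘ-cong {mkℚᵘ x 0 ℚᵘ.* mkℚᵘ y 0} {mkℚᵘ (x * y) 0} (*≡* refl))

quot-* : ∀ r q x y → + r * x ≡ y * + suc q → quot r (suc q) ℚ.* ι x ≡ ι y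
quot-* r q x y eq = trans (fromℚᵘ-* (mkℚᵘ (+ r) q) (mkℚᵘ x 0)) (ℚ.fromℚᵘ-cong {mkℚᵘ (+ r) q ℚᵘ.* mkℚᵘ x 0} {mkℚᵘ y 0} (*≡* (begin
  + r * x * 1ℤ           ≡⟨ ℤ.*-identityʳ (+ r * x) ⟩
  + r * x                ≡⟨ eq ⟩
  y * + suc q            ≡⟨ cong (λ d → y * + d) (ℕ.*-identityʳ (suc q)) ⟨
  y * + (suc q ℕ.* 1)    ∎)))
  where open ≡-Reasoning

-- The definition of `b` sums over i from 1 upwards, whereas `Γ` sums over p = j - i from 0 upwards.
Σ-reverse : ∀ n {f : ℕ → ℚ} (h : ℕ → ℤ) → (∀ i → 0 < i → i ≤ n → f i ≡ ι (h i)) →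
  Σ[1≤i≤ n ] f ≡ ι (∑[ p < n ] (h (n ∸ p)))
Σ-reverse zero    h f≗h = refl
Σ-reverse (suc n) {f} h f≗h = begin
  Σ[1≤i≤ n ] f ℚ.+ f (suc n)                      ≡⟨ cong₂ ℚ._+_ (Σ-reverse n h (λ i 0<i i≤n → f≗h i 0<i (ℕ.m≤n⇒m≤1+n i≤n)))
      (f≗h (suc n) (s≤s z≤n) ℕ.≤-refl) ⟩
  ι (∑[ p < n ] (h (n ∸ p))) ℚ.+ ι (h (suc n))    ≡⟨ ι-+ (∑[ p < n ] (h (n ∸ p))) (h (suc n)) ⟩
  ι (∑[ p < n ] (h (n ∸ p)) + h (suc n))          ≡⟨ cong ι (trans (ℤ.+-comm (∑[ p < n ] (h (n ∸ p))) (h (suc n)))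
      (sym (∑-front n (λ p → h (suc n ∸ p))))) ⟩
  ι (∑[ p < suc n ] (h (suc n ∸ p)))              ∎
  where open ≡-Reasoning

∑-truncate : ∀ {k n} f → k ≤ n → (∀ {p} → k ≤ p → f p ≡ 0ℤ) → ∑ n f ≡ ∑ k f
∑-truncate {n = zero}  f z≤n vanish = refl
∑-truncate {n = suc n} f k≤1+n vanish with ℕ.m≤n⇒m<n∨m≡n k≤1+n
... | inj₂ refl      = refl
... | inj₁ (s≤s k≤n) = trans (cong₂ _+_ (∑-truncate f k≤n vanish) (vanish k≤n)) (ℤ.+-identityʳ _)

-- With p = j - i and s = 2m - 2j, the denominator 2m - j - i is s + p. The positivity hypothesis
-- excludes only i = j = m, the case that the definition of `b` treats apart.
term-ι : ∀ m s p i → 2 ℕ.* m ≡ s ℕ.+ 2 ℕ.* (p ℕ.+ i) → 0 < s ℕ.+ p →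
  term m (p ℕ.+ i) i ≡ ι (c s p * Jℤ (2 ℕ.* m) (+ i))
term-ι m s p i 2m≡ 0<s+p = begin
  term m (p ℕ.+ i) i
    ≡⟨ cong₂ ℚ._*_ (cong₂ ℚ._*_ (cong₂ ℚ._*_ (cong (λ x → ι (-1ℤ ^ x)) p≡) (cong₂ quot 2m-2i≡ 2m-j-i≡))
        (cong₂ (λ x y → ι (+ (x C y))) 2m-j-i≡ p≡)) (cong ι (J≡Jℤ (2 ℕ.* m) i)) ⟩
  ι (-1ℤ ^ p) ℚ.* quot (s ℕ.+ 2 ℕ.* p) (s ℕ.+ p) ℚ.* ι (+ ((s ℕ.+ p) C p)) ℚ.* ι (Jℤ (2 ℕ.* m) (+ i))
    ≡⟨ cong (ℚ._* ι (Jℤ (2 ℕ.* m) (+ i))) (ℚ.*-assoc (ι (-1ℤ ^ p)) _ _) ⟩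
  ι (-1ℤ ^ p) ℚ.* (quot (s ℕ.+ 2 ℕ.* p) (s ℕ.+ p) ℚ.* ι (+ ((s ℕ.+ p) C p))) ℚ.* ι (Jℤ (2 ℕ.* m) (+ i))
    ≡⟨ cong (λ x → ι (-1ℤ ^ p) ℚ.* x ℚ.* ι (Jℤ (2 ℕ.* m) (+ i))) (quot-L (s ℕ.+ p) refl 0<s+p) ⟩
  ι (-1ℤ ^ p) ℚ.* ι (L s p) ℚ.* ι (Jℤ (2 ℕ.* m) (+ i))
    ≡⟨ trans (cong (ℚ._* ι (Jℤ (2 ℕ.* m) (+ i))) (ι-* (-1ℤ ^ p) (L s p))) (ι-* (c s p) (Jℤ (2 ℕ.* m) (+ i))) ⟩
  ι (c s p * Jℤ (2 ℕ.* m) (+ i)) ∎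
  where
  open ≡-Reasoning
  p≡ : p ℕ.+ i ∸ i ≡ p
  p≡ = ℕ.m+n∸n≡m p i
  2m≡s+2p+2i : 2 ℕ.* m ≡ s ℕ.+ 2 ℕ.* p ℕ.+ 2 ℕ.* i
  2m≡s+2p+2i = trans 2m≡ (trans (cong (s ℕ.+_) (ℕ.*-distribˡ-+ 2 p i)) (sym (ℕ.+-assoc s (2 ℕ.* p) (2 ℕ.* i))))
  2m-2i≡ : 2 ℕ.* m ∸ 2 ℕ.* i ≡ s ℕ.+ 2 ℕ.* p
  2m-2i≡ = trans (cong (_∸ 2 ℕ.* i) 2m≡s+2p+2i) (ℕ.m+n∸n≡m (s ℕ.+ 2 ℕ.* p) (2 ℕ.* i))
  2m-j-i≡ : 2 ℕ.* m ∸ (p ℕ.+ i) ∸ i ≡ s ℕ.+ p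
  2m-j-i≡ = trans (cong (λ x → x ∸ (p ℕ.+ i) ∸ i) (trans 2m≡ (trans (cong (λ x → s ℕ.+ (p ℕ.+ i ℕ.+ x)) (ℕ.+-identityʳ (p ℕ.+ i)))
    (sym (ℕ.+-assoc s (p ℕ.+ i) (p ℕ.+ i))))))
    (trans (cong (_∸ i) (ℕ.m+n∸n≡m (s ℕ.+ (p ℕ.+ i)) (p ℕ.+ i))) (trans (cong (_∸ i) (sym (ℕ.+-assoc s p i))) (ℕ.m+n∸n≡m (s ℕ.+ p) i)))
  quot-L : ∀ n → s ℕ.+ p ≡ n → 0 < n → quot (s ℕ.+ 2 ℕ.* p) (s ℕ.+ p) ℚ.* ι (+ ((s ℕ.+ p) C p)) ≡ ι (L s p)
  quot-L (suc n) eq _ = subst (λ x → quot (s ℕ.+ 2 ℕ.* p) x ℚ.* ι (+ ((s ℕ.+ p) C p)) ≡ ι (L s p)) (sym eq)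
    (quot-* (s ℕ.+ 2 ℕ.* p) n (+ ((s ℕ.+ p) C p)) (L s p) (trans (cong (_* + ((s ℕ.+ p) C p))
        (trans (ℤ.pos-+ s (2 ℕ.* p)) (cong (λ x → + s + x) (ℤ.pos-* 2 p)))) (trans (L-C s p) (cong (λ x → L s p * + x) eq))))

-- Beyond p = j there remain the index 0, where J vanishes by `Jℤ-at-0`, and negative indices.
Γ-reverse : ∀ m s j {n} → suc j < n →
  Γ (Jℤ (2 ℕ.* suc m)) s (+ suc j) n ≡ ∑[ p < suc j ] (c s (suc j ∸ (suc j ∸ p)) * Jℤ (2 ℕ.* suc m) (+ (suc j ∸ p)))
Γ-reverse m s j {n} 1+j<n = trans
  (∑-truncate (λ p → c s p * Jℤ M (+ suc j - + p)) (ℕ.<⇒≤ 1+j<n) (λ {p} j<p → trans (cong (c s p *_) (vanish j<p)) (ℤ.*-zeroʳ (c s p))))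
  (∑-cong (suc j) (λ {p} p≤j → cong₂ (λ x y → c s x * Jℤ M y) (sym (ℕ.m∸[m∸n]≡n (ℕ.<⇒≤ p≤j)))
    (trans (ℤ.[+m]-[+n]≡m⊖n (suc j) p) (ℤ.⊖-≥ (ℕ.<⇒≤ p≤j)))))
  where
  M : ℕ
  M = 2 ℕ.* suc m
  vanish : ∀ {p} → suc j ≤ p → Jℤ M (+ suc j - + p) ≡ 0ℤ
  vanish j<p with ℕ.m≤n⇒m<n∨m≡n j<p
  ... | inj₁ 1+j<p = Jℤ-vanishes M 1+j<p
  ... | inj₂ refl  = trans (cong (Jℤ M) (ℤ.+-inverseʳ (+ suc j))) (Jℤ-at-0 m)

b-large : ∀ {m k} → m < k → b m (+ k) ≡ 0ℚ
b-large {m} {suc k} m<k with ℕ.<-cmp (suc k) m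
... | tri< k<m _ _  = contradiction k<m (ℕ.<⇒≯ m<k)
... | tri≈ _ refl _ = contradiction m<k (ℕ.<-irrefl refl)
... | tri> _ _ _    = refl

b-Γ-suc : ∀ m s j {n} → 2 ℕ.* suc m ≡ s ℕ.+ 2 ℕ.* suc j → suc j < n → b (suc m) (+ suc j) ≡ ι (Γ (Jℤ (2 ℕ.* suc m)) s (+ suc j) n)
b-Γ-suc m s j {n} 2m≡ 1+j<n = trans sums (cong ι (sym (Γ-reverse m s j 1+j<n)))
  where
  h : ℕ → ℤ
  h i = c s (suc j ∸ i) * Jℤ (2 ℕ.* suc m) (+ i)
  terms : ∀ i → i ≤ suc j → 0 < s ℕ.+ (suc j ∸ i) → term (suc m) (suc j) i ≡ ι (h i)
  terms i i≤1+j pos = subst (λ x → term (suc m) x i ≡ ι (h i)) (ℕ.m∸n+n≡m i≤1+j)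
    (term-ι (suc m) s (suc j ∸ i) i (trans 2m≡ (cong (λ x → s ℕ.+ 2 ℕ.* x) (sym (ℕ.m∸n+n≡m i≤1+j)))) pos)
  sums : b (suc m) (+ suc j) ≡ ι (∑[ p < suc j ] (h (suc j ∸ p)))
  sums with ℕ.<-cmp (suc j) (suc m)
  ... | tri< j<m _ _ = Σ-reverse (suc j) h (λ i _ i≤1+j → terms i i≤1+j (ℕ.<-≤-trans s>0 (ℕ.m≤m+n s (suc j ∸ i))))
    where
    s>0 : 0 < s
    s>0 = ℕ.n≢0⇒n>0 (λ s≡0 → ℕ.<⇒≢ j<m (sym (ℕ.*-cancelˡ-≡ (suc m) (suc j) 2 (trans 2m≡ (cong (ℕ._+ 2 ℕ.* suc j) s≡0)))))
  -- For j = m the term i = m would have the quotient 0/0. The separate summand J takes its place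
  -- and matches c s 0 = 1; for i < m the difference m - i alone makes the denominator positive.
  ... | tri≈ _ refl _ = begin
    ι (+ J (2 ℕ.* suc m) (suc m)) ℚ.+ Σ[1≤i≤ m ] (term (suc m) (suc m))
      ≡⟨ ℚ.+-comm (ι (+ J (2 ℕ.* suc m) (suc m))) _ ⟩
    Σ[1≤i≤ m ] (term (suc m) (suc m)) ℚ.+ ι (+ J (2 ℕ.* suc m) (suc m))
      ≡⟨ cong₂ ℚ._+_ (Σ-reverse m h (λ i _ i≤m → terms i (ℕ.m≤n⇒m≤1+n i≤m) (ℕ.<-≤-trans (ℕ.m<n⇒0<n∸m (s≤s i≤m)) (ℕ.m≤n+m (suc m ∸ i) s))))
           (cong ι (trans (J≡Jℤ (2 ℕ.* suc m) (suc m)) (trans (sym (ℤ.*-identityˡ _))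
               (cong (λ x → c s x * Jℤ (2 ℕ.* suc m) (+ suc m)) (sym (ℕ.n∸n≡0 m)))))) ⟩
    ι (∑[ p < m ] (h (m ∸ p))) ℚ.+ ι (h (suc m))
      ≡⟨ ι-+ (∑[ p < m ] (h (m ∸ p))) (h (suc m)) ⟩
    ι (∑[ p < m ] (h (m ∸ p)) + h (suc m))
      ≡⟨ cong ι (trans (ℤ.+-comm (∑[ p < m ] (h (m ∸ p))) (h (suc m))) (sym (∑-front m (λ p → h (suc m ∸ p))))) ⟩
    ι (∑[ p < suc m ] (h (suc m ∸ p))) ∎
    where open ≡-Reasoning
  ... | tri> _ _ m<j = contradiction 2m≡ (ℕ.<⇒≢ (ℕ.<-≤-trans (ℕ.*-monoʳ-< 2 m<j) (ℕ.m≤n+m (2 ℕ.* suc j) s)))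

-- Admitting every integer z lets k - 1 and k - 2 be treated like k: for z ≤ 0 both sides are 0. The
-- equation for 2m forces z ≤ m, because s is a natural number.
b-Γ : ∀ m s z n → + (2 ℕ.* suc m) ≡ + s + + 2 * z → z ℤ.< + n → b (suc m) z ≡ ι (Γ (Jℤ (2 ℕ.* suc m)) s z n)
b-Γ m s (+ suc j) n 2m≡ (ℤ.+<+ 1+j<n) = b-Γ-suc m s j (ℤ.+-injective (trans 2m≡
    (trans (cong (λ x → + s + x) (sym (ℤ.pos-* 2 (suc j)))) (sym (ℤ.pos-+ s (2 ℕ.* suc j)))))) 1+j<n
b-Γ m s (+ zero) n _ _ = cong ι (sym (∑-zero n (λ {p} _ → trans (cong (c s p *_) (vanish p)) (ℤ.*-zeroʳ (c s p)))))
  where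
  vanish : ∀ p → Jℤ (2 ℕ.* suc m) (0ℤ - + p) ≡ 0ℤ
  vanish zero    = Jℤ-at-0 m
  vanish (suc p) = Jℤ-negative (2 ℕ.* suc m) p
b-Γ m s -[1+ a ] n _ _ = cong ι (sym (∑-zero n (λ {p} _ → trans (cong (c s p *_) (vanish p)) (ℤ.*-zeroʳ (c s p)))))
  where
  vanish : ∀ p → Jℤ (2 ℕ.* suc m) (-[1+ a ] - + p) ≡ 0ℤ
  vanish zero    = Jℤ-negative (2 ℕ.* suc m) a
  vanish (suc p) = Jℤ-negative (2 ℕ.* suc m) (suc (a ℕ.+ p))

ι-combine : ∀ x a b′ c′ g g₀ g₁ g₂ {B B₀ B₁ B₂ : ℚ} → B ≡ ι g → B₀ ≡ ι g₀ → B₁ ≡ ι g₁ → B₂ ≡ ι g₂ →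
  x * g ≡ a * g₀ + b′ * g₁ + c′ * g₂ → ι x ℚ.* B ≡ ι a ℚ.* B₀ ℚ.+ ι b′ ℚ.* B₁ ℚ.+ ι c′ ℚ.* B₂
ι-combine x a b′ c′ g g₀ g₁ g₂ refl refl refl refl eq = begin
  ι x ℚ.* ι g                                                ≡⟨ ι-* x g ⟩
  ι (x * g)                                                  ≡⟨ cong ι eq ⟩
  ι (a * g₀ + b′ * g₁ + c′ * g₂)                             ≡⟨ trans (cong (ℚ._+ ι (c′ * g₂)) (ι-+ (a * g₀) (b′ * g₁)))
      (ι-+ (a * g₀ + b′ * g₁) (c′ * g₂)) ⟨
  ι (a * g₀) ℚ.+ ι (b′ * g₁) ℚ.+ ι (c′ * g₂)                 ≡⟨ cong₂ ℚ._+_ (cong₂ ℚ._+_ (ι-* a g₀) (ι-* b′ g₁)) (ι-* c′ g₂) ⟨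
  ι a ℚ.* ι g₀ ℚ.+ ι b′ ℚ.* ι g₁ ℚ.+ ι c′ ℚ.* ι g₂           ∎
  where open ≡-Reasoning

-- The three ranges k < n, k = n and k > n

κ₀ κ₁ κ₂ : ℤ → ℤ → ℤ
κ₀ N K = K * (K + 1ℤ) + + 2 * N - + 2
κ₁ N K = + 2 + + 2 * (K - 1ℤ) * (+ 4 * N - + 4 * K - + 3)
κ₂ N K = + 8 * (N - K + 1ℤ) * (+ 2 * N - + 2 * K + 1ℤ)

GammaRecurrence : ℕ → ℕ → Set
GammaRecurrence n k = let N = + n ; K = + k in
  ι (+ 2 * N) ℚ.* b n K ≡
    ι (κ₀ N K) ℚ.* b (n ∸ 1) K ℚ.+ ι (κ₁ N K) ℚ.* b (n ∸ 1) (K - 1ℤ) ℚ.+ ι (κ₂ N K) ℚ.* b (n ∸ 1) (K - + 2)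

2*suc : ∀ m → + (2 ℕ.* suc m) ≡ + 2 * (1ℤ + + m)
2*suc m = ℤ.pos-* 2 (suc m)

module _ (m k : ℕ) where

  private
    N K : ℤ
    N = + (2 ℕ.+ m)
    K = + k

    M : ℕ
    M = 2 ℕ.* suc m

    M≡ : + M ≡ + 2 * N - + 2
    M≡ = trans (2*suc m) (lem (+ m))
      where
      lem : ∀ m → + 2 * (1ℤ + m) ≡ + 2 * (+ 2 + m) - + 2
      lem = solve-∀

    2N≡ : + suc (suc M) ≡ + 2 * N
    2N≡ = trans (cong (λ x → + 2 + x) M≡) (lem N)
      where
      lem : ∀ n → + 2 + (+ 2 * n - + 2) ≡ + 2 * n
      lem = solve-∀

    α≡ : α (+ M) K ≡ K * (K + 1ℤ) + + 2 * N - + 2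
    α≡ = trans (cong (λ x → K * (K + 1ℤ) + x) M≡) (lem (K * (K + 1ℤ)) (+ 2 * N))
      where
      lem : ∀ x y → x + (y - + 2) ≡ x + y - + 2
      lem = solve-∀

    K-j<1+k : ∀ j → K - + j ℤ.< + suc k
    K-j<1+k j = ℤ.≤-<-trans (ℤ.i-j≤i K (+ j)) (ℤ.+<+ ℕ.≤-refl)

    index : ∀ s → + M ≡ + s + + 2 * K → ∀ j → + M ≡ + (2 ℕ.* j ℕ.+ s) + + 2 * (K - + j)
    index s eq j = trans eq (trans (lem (+ s) K (+ j)) (cong (λ x → x + + 2 * (K - + j))
        (sym (trans (ℤ.pos-+ (2 ℕ.* j) s) (cong (_+ + s) (ℤ.pos-* 2 j))))))
      where
      lem : ∀ s k j → s + + 2 * k ≡ + 2 * j + s + + 2 * (k - j)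
      lem = solve-∀

    b-upper : ∀ s → + 2 * N ≡ + s + + 2 * K → b (2 ℕ.+ m) K ≡ ι (Γ (Jℤ (suc (suc M))) s K (suc k))
    b-upper s eq = trans (b-Γ (suc m) s K (suc k) (trans (2*suc (suc m)) eq) (ℤ.+<+ ℕ.≤-refl))
        (cong (λ x → ι (Γ (Jℤ x) s K (suc k))) (ℕ.*-suc 2 (suc m)))

  lower-case : k ≤ suc m → GammaRecurrence (2 ℕ.+ m) k
  lower-case k≤1+m = ι-combine (+ 2 * N) (κ₀ N K) (κ₁ N K) (κ₂ N K) (Γ (Jℤ (suc (suc M))) (2 ℕ.+ t) K (suc k)) g₀ g₁ g₂
    (b-upper (2 ℕ.+ t) (trans (sym 2N≡) (trans (cong (λ x → + 2 + x) M≡t+2K) (sym (ℤ.+-assoc (+ 2) (+ t) (+ 2 * K))))))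
    (b-Γ m t K (suc k) M≡t+2K (ℤ.+<+ ℕ.≤-refl))
    (b-Γ m (2 ℕ.+ t) (K - 1ℤ) (suc k) (index t M≡t+2K 1) (K-j<1+k 1))
    (b-Γ m (4 ℕ.+ t) (K - + 2) (suc k) (index t M≡t+2K 2) (K-j<1+k 2))
    (begin
      + 2 * N * Γ (Jℤ (suc (suc M))) (2 ℕ.+ t) K (suc k)
        ≡⟨ cong (_* Γ (Jℤ (suc (suc M))) (2 ℕ.+ t) K (suc k)) 2N≡ ⟨
      + suc (suc M) * Γ (Jℤ (suc (suc M))) (2 ℕ.+ t) K (suc k)
        ≡⟨ Γ-recurrence M K (suc k) (λ _ → Jℤ-vanishes M) t M≡t+2K ⟩
      α (+ M) K * g₀ + (+ 2 + + 2 * (K - 1ℤ) * (+ 2 * s - + 3)) * g₁ + + 4 * (s + + 2) * (s + 1ℤ) * g₂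
        ≡⟨ cong₂ (λ x y → x * g₀ + (+ 2 + + 2 * (K - 1ℤ) * (+ 2 * y - + 3)) * g₁ + + 4 * (y + + 2) * (y + 1ℤ) * g₂) α≡ s≡ ⟩
      (K * (K + 1ℤ) + + 2 * N - + 2) * g₀ + (+ 2 + + 2 * (K - 1ℤ) * (+ 2 * (+ 2 * N - + 2 * K) - + 3)) * g₁ + + 4 *
          (+ 2 * N - + 2 * K + + 2) * (+ 2 * N - + 2 * K + 1ℤ) * g₂
        ≡⟨ coefficients N K g₀ g₁ g₂ ⟩
      (K * (K + 1ℤ) + + 2 * N - + 2) * g₀ + (+ 2 + + 2 * (K - 1ℤ) * (+ 4 * N - + 4 * K - + 3)) * g₁ + + 8 * (N - K + 1ℤ) *
          (+ 2 * N - + 2 * K + 1ℤ) * g₂ ∎)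
    where
    open ≡-Reasoning
    t : ℕ
    t = M ∸ 2 ℕ.* k
    s g₀ g₁ g₂ : ℤ
    s  = + 2 + + t
    g₀ = Γ (Jℤ M) t K (suc k)
    g₁ = Γ (Jℤ M) (2 ℕ.+ t) (K - 1ℤ) (suc k)
    g₂ = Γ (Jℤ M) (4 ℕ.+ t) (K - + 2) (suc k)
    M≡t+2K : + M ≡ + t + + 2 * K
    M≡t+2K = trans (cong (λ x → + x) (sym (ℕ.m∸n+n≡m (ℕ.*-monoʳ-≤ 2 k≤1+m)))) (trans (ℤ.pos-+ t (2 ℕ.* k)) (cong (λ x → + t + x) (ℤ.pos-* 2 k)))
    s≡ : s ≡ + 2 * N - + 2 * K
    s≡ = trans (lem (+ t) K) (cong (_- + 2 * K) (trans (cong (λ x → + 2 + x) (sym M≡t+2K)) 2N≡))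
      where
      lem : ∀ t k → + 2 + t ≡ + 2 + (t + + 2 * k) - + 2 * k
      lem = solve-∀
    coefficients : ∀ n k x y z →
      (k * (k + 1ℤ) + + 2 * n - + 2) * x + (+ 2 + + 2 * (k - 1ℤ) * (+ 2 * (+ 2 * n - + 2 * k) - + 3)) * y + + 4 *
          (+ 2 * n - + 2 * k + + 2) * (+ 2 * n - + 2 * k + 1ℤ) * z ≡
      (k * (k + 1ℤ) + + 2 * n - + 2) * x + (+ 2 + + 2 * (k - 1ℤ) * (+ 4 * n - + 4 * k - + 3)) * y + + 8 * (n - k + 1ℤ) * (+ 2 * n - + 2 * k + 1ℤ) * z
    coefficients = solve-∀

  middle-case : k ≡ 2 ℕ.+ m → GammaRecurrence (2 ℕ.+ m) k
  middle-case refl = ι-combine (+ 2 * N) (κ₀ N K) (κ₁ N K) (κ₂ N K) (Γ (Jℤ (suc (suc M))) 0 K (suc k)) 0ℤ g₁ g₂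
    (b-upper 0 (sym (ℤ.+-identityˡ (+ 2 * N))))
    -- Here b_{2n-2,n} is 0 by convention and not an alternating sum, which is why the value 0
    -- stands in for the first Γ.
    (b-large {suc m} ℕ.≤-refl)
    (b-Γ m 0 (K - 1ℤ) (suc k) (trans M≡ (index₁ N)) (K-j<1+k 1))
    (b-Γ m 2 (K - + 2) (suc k) (trans M≡ (index₂ N)) (K-j<1+k 2))
    (begin
      + 2 * N * Γ (Jℤ (suc (suc M))) 0 K (suc k)
        ≡⟨ cong (_* Γ (Jℤ (suc (suc M))) 0 K (suc k)) 2N≡ ⟨
      + suc (suc M) * Γ (Jℤ (suc (suc M))) 0 K (suc k)
        ≡⟨ Γ-recurrence-middle m ⟩
      α (+ M) K * 0ℤ + (+ 2 + + 2 * (K - 1ℤ) * - + 3) * g₁ + + 8 * g₂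
        ≡⟨ cong (λ x → x * 0ℤ + (+ 2 + + 2 * (K - 1ℤ) * - + 3) * g₁ + + 8 * g₂) α≡ ⟩
      (K * (K + 1ℤ) + + 2 * N - + 2) * 0ℤ + (+ 2 + + 2 * (K - 1ℤ) * - + 3) * g₁ + + 8 * g₂
        ≡⟨ coefficients N g₁ g₂ ⟩
      (K * (K + 1ℤ) + + 2 * N - + 2) * 0ℤ + (+ 2 + + 2 * (K - 1ℤ) * (+ 4 * N - + 4 * K - + 3)) * g₁ + + 8 * (N - K + 1ℤ) *
          (+ 2 * N - + 2 * K + 1ℤ) * g₂ ∎)
    where
    open ≡-Reasoning
    g₁ g₂ : ℤ
    g₁ = Γ (Jℤ M) 0 (K - 1ℤ) (suc k)
    g₂ = Γ (Jℤ M) 2 (K - + 2) (suc k)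
    index₁ : ∀ n → + 2 * n - + 2 ≡ 0ℤ + + 2 * (n - 1ℤ)
    index₁ = solve-∀
    index₂ : ∀ n → + 2 * n - + 2 ≡ + 2 + + 2 * (n - + 2)
    index₂ = solve-∀
    coefficients : ∀ n y z →
      (n * (n + 1ℤ) + + 2 * n - + 2) * 0ℤ + (+ 2 + + 2 * (n - 1ℤ) * - + 3) * y + + 8 * z ≡
      (n * (n + 1ℤ) + + 2 * n - + 2) * 0ℤ + (+ 2 + + 2 * (n - 1ℤ) * (+ 4 * n - + 4 * n - + 3)) * y + + 8 * (n - n + 1ℤ) * (+ 2 * n - + 2 * n + 1ℤ) * z
    coefficients = solve-∀

-- All terms except the last vanish by the convention. The last one survives only for k = n + 1, and
-- there the factor n - k + 1 is 0.
beyond-case : ∀ m k → m ≤ k → GammaRecurrence (2 ℕ.+ m) (3 ℕ.+ k)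
beyond-case m k m≤k = cases (ℕ.m≤n⇒m<n∨m≡n m≤k)
  where
  N K : ℤ
  N = + (2 ℕ.+ m)
  K = + (3 ℕ.+ k)
  from-last : ∀ g → b (suc m) (+ suc k) ≡ ι g → κ₂ N K * g ≡ 0ℤ → GammaRecurrence (2 ℕ.+ m) (3 ℕ.+ k)
  from-last g last product = ι-combine (+ 2 * N) (κ₀ N K) (κ₁ N K) (κ₂ N K) 0ℤ 0ℤ 0ℤ g
    (b-large {2 ℕ.+ m} {3 ℕ.+ k} (s≤s (s≤s (s≤s m≤k))))
    (b-large {suc m} {3 ℕ.+ k} (ℕ.m≤n⇒m≤1+n (s≤s (s≤s m≤k))))
    (b-large {suc m} {2 ℕ.+ k} (s≤s (s≤s m≤k)))
    last
    (sym (trans (cong (λ x → κ₀ N K * 0ℤ + κ₁ N K * 0ℤ + x) product) (zeros (κ₀ N K) (κ₁ N K) (+ 2 * N))))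
    where
    zeros : ∀ x y z → x * 0ℤ + y * 0ℤ + 0ℤ ≡ z * 0ℤ
    zeros = solve-∀
  cases : m < k ⊎ m ≡ k → GammaRecurrence (2 ℕ.+ m) (3 ℕ.+ k)
  cases (inj₁ m<k)  = from-last 0ℤ (b-large {suc m} {suc k} (s≤s m<k)) (ℤ.*-zeroʳ (κ₂ N K))
  cases (inj₂ refl) = from-last (Γ (Jℤ (2 ℕ.* suc m)) 0 (+ suc m) (2 ℕ.+ m))
    (b-Γ m 0 (+ suc m) (2 ℕ.+ m) (trans (2*suc m) (sym (ℤ.+-identityˡ (+ 2 * + suc m)))) (ℤ.+<+ ℕ.≤-refl))
    (lem (+ m) (Γ (Jℤ (2 ℕ.* suc m)) 0 (+ suc m) (2 ℕ.+ m)))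
    where
    lem : ∀ m g → let N = + 2 + m ; K = + 3 + m in + 8 * (N - K + 1ℤ) * (+ 2 * N - + 2 * K + 1ℤ) * g ≡ 0ℤ
    lem = solve-∀

theorem4p4 : (n k : ℕ) → 2 ≤ n → 1 ≤ k →
  let N = + n
      K = + k
  in
  ((+ 2 ℤ.* N) / 1) ℚ.* b n K
    ≡ ((K ℤ.* (K ℤ.+ + 1) ℤ.+ + 2 ℤ.* N ℤ.- + 2) / 1) ℚ.* b (n ∸ 1) K
      ℚ.+ ((+ 2 ℤ.+ + 2 ℤ.* (K ℤ.- + 1) ℤ.* (+ 4 ℤ.* N ℤ.- + 4 ℤ.* K ℤ.- + 3)) / 1) ℚ.* b (n ∸ 1) (K ℤ.- + 1)
      ℚ.+ ((+ 8 ℤ.* (N ℤ.- K ℤ.+ + 1) ℤ.* (+ 2 ℤ.* N ℤ.- + 2 ℤ.* K ℤ.+ + 1)) / 1) ℚ.* b (n ∸ 1) (K ℤ.- + 2)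
theorem4p4 (suc (suc m)) k (s≤s (s≤s z≤n)) _ with ℕ.<-cmp k (2 ℕ.+ m)
... | tri< k<n _ _ = lower-case m k (ℕ.s≤s⁻¹ k<n)
... | tri≈ _ k≡n _ = middle-case m k k≡n
-- The inequality k > n = m + 2 exposes three successors of k, so that k - 1 and k - 2 reduce to
-- positive literals.
... | tri> _ _ (s≤s (s≤s (s≤s {n = k} m≤k))) = beyond-case m k m≤k
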